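{- Let $p$ be a prime with $p\equiv -1\pmod 6$. Then for all integers $\alpha\ge1$ and $n\ge0$, \[ b_{8}\!\left(p^{2\alpha}n+\frac{(24i+7p)p^{2\alpha-1}-7}{24}\right)\equiv 0 \pmod 2 \] for each $i=1,\ldots,p-1$.
   Context: For a positive integer $\ell$, $b_\ell(n)$ denotes the number of partitions of $n$ having no part divisible by $\ell$. -}

module Defs where

open import Data.Nat using (ℕ; zero; suc; _+_; _*_; _∸_; _^_; _/_; _≤_; _≥_; _⊓_; s≤s; s≤s⁻¹; NonZero)
open import Data.Nat.Properties
open import Data.Nat.DivMod using (m*n/n≡m)
open import Data.Nat.Divisibility using (_∣_; _∣?_; divides)
open import Data.Nat.ListAction using (sum)
open import Data.Nat.Tactic.RingSolver using (solve-∀)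
open import Data.List using (List; []; _∷_; map; concatMap; upTo; filter; length)
open import Data.List.Properties using (∷-injectiveˡ; ∷-injectiveʳ)
open import Data.List.Relation.Unary.All as All using (All; []; _∷_; all?)
open import Data.List.Relation.Unary.AllPairs as AllPairs using ([]; _∷_)
import Data.List.Relation.Unary.AllPairs.Properties as AllPairsₚ
import Data.List.Relation.Unary.All.Properties as Allₚ
open import Data.List.Relation.Unary.Any using (here; there)
open import Data.List.Relation.Unary.Linked using (Linked; []; [-]; _∷_)
open import Data.List.Relation.Unary.Unique.Propositional using (Unique)
import Data.List.Relation.Unary.Unique.Propositional.Properties as Uniqueₚ
open import Data.List.Membership.Propositional using (_∈_; find; lose)
open import Data.List.Membership.Propositional.Properties
open import Data.Product using (_×_; _,_; proj₁; proj₂; ∃-syntax)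
open import Function.Bundles using (_⇔_; mk⇔)
open import Relation.Nullary using (¬_)
open import Relation.Nullary.Decidable using (¬?)
open import Relation.Unary using (Decidable)
open import Relation.Binary.PropositionalEquality

record IsPartition (n : ℕ) (xs : List ℕ) : Set where
  constructor mkPartition
  field
    positive   : All NonZero xs
    decreasing : Linked _≥_ xs
    total      : sum xs ≡ n

IsRegular : ℕ → List ℕ → Set
IsRegular ℓ = All (λ x → ¬ (ℓ ∣ x))

isRegular? : ∀ ℓ → Decidable (IsRegular ℓ)
isRegular? ℓ = all? (λ x → ¬? (ℓ ∣? x))

-- Partitions of n with all parts at most k, by largest part suc j.
-- The first argument only drives the recursion; any value ≥ n gives the
-- full enumeration.
partitions≤ : ℕ → ℕ → ℕ → List (List ℕ)
partitions≤ _       k zero    = [] ∷ []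
partitions≤ zero    k (suc n) = []
partitions≤ (suc f) k (suc n) =
  concatMap (λ j → map (suc j ∷_) (partitions≤ f (suc j) (n ∸ j))) (upTo (k ⊓ suc n))

partitions : ℕ → List (List ℕ)
partitions n = partitions≤ n n n

b : ℕ → ℕ → ℕ
b ℓ n = length (filter (isRegular? ℓ) (partitions n))

-- The list counted by b ℓ n contains exactly the ℓ-regular partitions of n,
-- each once: regular-partitions and regular-partitions-unique.

private

  Bounded : ℕ → ℕ → List ℕ → Set
  Bounded k n xs = All NonZero xs × Linked _≥_ (k ∷ xs) × sum xs ≡ n

  sound : ∀ f k n {xs} → xs ∈ partitions≤ f k n → Bounded k n xs
  sound zero    k zero    (here refl) = [] , [-] , refl
  sound (suc f) k zero    (here refl) = [] , [-] , refl
  sound (suc f) k (suc n) xs∈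
    with j , j∈ , xs∈′ ← find (∈-concatMap⁻ _ {xs = upTo (k ⊓ suc n)} xs∈)
    with ys , ys∈ , refl ← ∈-map⁻ (suc j ∷_) xs∈′
    with pos , dec , tot ← sound f (suc j) (n ∸ j) ys∈
    = _ ∷ pos
    , ≤-trans (∈-upTo⁻ j∈) (m⊓n≤m k (suc n)) ∷ dec
    , cong suc (trans (cong (j +_) tot)
        (m+[n∸m]≡n (s≤s⁻¹ (≤-trans (∈-upTo⁻ j∈) (m⊓n≤n k (suc n))))))

  complete : ∀ f k n {xs} → n ≤ f → Bounded k n xs → xs ∈ partitions≤ f k n
  complete zero    k zero    {[]} _ _ = here refl
  complete (suc f) k zero    {[]} _ _ = here refl
  complete f       k zero    {suc x ∷ xs} _ (_ , _ , ())
  complete f       k n       {zero ∷ xs} _ (() ∷ _ , _ , _)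
  complete (suc f) k (suc n) {suc j ∷ xs} (s≤s n≤f) (_ ∷ pos , j<k ∷ dec , tot) =
    ∈-concatMap⁺ _ {xs = upTo (k ⊓ suc n)} (lose (∈-upTo⁺ (⊓-glb j<k (s≤s j≤n)))
      (∈-map⁺ (suc j ∷_)
        (complete f (suc j) (n ∸ j) (≤-trans (m∸n≤m n j) n≤f) (pos , dec , rest))))
    where
      tot′ : j + sum xs ≡ n
      tot′ = suc-injective tot
      j≤n : j ≤ n
      j≤n = subst (j ≤_) tot′ (m≤m+n j (sum xs))
      rest : sum xs ≡ n ∸ j
      rest = trans (sym (m+n∸m≡n j (sum xs))) (cong (_∸ j) tot′)

  unique≤ : ∀ f k n → Unique (partitions≤ f k n)
  unique≤ zero    k zero    = [] ∷ []
  unique≤ (suc f) k zero    = [] ∷ []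
  unique≤ zero    k (suc n) = []
  unique≤ (suc f) k (suc n) = Uniqueₚ.concat⁺
    (Allₚ.map⁺ (All.universal (λ j → Uniqueₚ.map⁺ ∷-injectiveʳ (unique≤ f (suc j) (n ∸ j))) _))
    (AllPairsₚ.map⁺ (AllPairs.map disjoint (Uniqueₚ.upTo⁺ (k ⊓ suc n))))
    where
      disjoint : ∀ {i j} → i ≢ j → ∀ {xs} →
        ¬ (xs ∈ map (suc i ∷_) (partitions≤ f (suc i) (n ∸ i)) ×
           xs ∈ map (suc j ∷_) (partitions≤ f (suc j) (n ∸ j)))
      disjoint i≢j (p , q)
        with _ , _ , refl ← ∈-map⁻ _ p
        with _ , _ , eq   ← ∈-map⁻ _ q
        = i≢j (suc-injective (∷-injectiveˡ eq))

  bounded : ∀ {n xs} → IsPartition n xs → Bounded n n xs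
  bounded {xs = []}     (mkPartition pos _   tot)  = pos , [-] , tot
  bounded {xs = x ∷ xs} (mkPartition pos dec refl) = pos , m≤m+n x (sum xs) ∷ dec , refl

  unbound : ∀ {k n xs} → Bounded k n xs → IsPartition n xs
  unbound (pos , [-]     , tot) = mkPartition pos []  tot
  unbound (pos , _ ∷ dec , tot) = mkPartition pos dec tot

regular-partitions : ∀ ℓ n xs →
  xs ∈ filter (isRegular? ℓ) (partitions n) ⇔ (IsPartition n xs × IsRegular ℓ xs)
regular-partitions ℓ n xs = mk⇔
  (λ xs∈ → let xs∈′ , reg = ∈-filter⁻ (isRegular? ℓ) {xs = partitions n} xs∈
           in unbound (sound n n n xs∈′) , reg)
  (λ (part , reg) → ∈-filter⁺ (isRegular? ℓ) (complete n n n ≤-refl (bounded part)) reg)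

regular-partitions-unique : ∀ ℓ n → Unique (filter (isRegular? ℓ) (partitions n))
regular-partitions-unique ℓ n = Uniqueₚ.filter⁺ (isRegular? ℓ) (unique≤ n n n)

private

  double : ∀ k → ∃[ c ] k * (3 * k + 5) ≡ 2 * c
  double zero    = 0 , refl
  double (suc k) = let c , eq = double k in
    c + (3 * k + 4) , trans (step k) (trans (cong (_+ 2 * (3 * k + 4)) eq) (sym (*-distribˡ-+ 2 c _)))
    where
      step : ∀ k → suc k * (3 * suc k + 5) ≡ k * (3 * k + 5) + 2 * (3 * k + 4)
      step = solve-∀

  square : ∀ p → 6 ∣ p + 1 → ∃[ c ] p * p ≡ 1 + c * 24
  square p (divides zero eq) with () ← trans (+-comm 1 p) eq
  square p (divides (suc q) eq)
    with refl ← suc-injective (trans (+-comm 1 p) eq)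
    = let c , e = double q in 1 + c , trans (expand q) (trans (cong (λ t → 25 + 12 * t) e) (collect c))
    where
      expand : ∀ q → (5 + q * 6) * (5 + q * 6) ≡ 25 + 12 * (q * (3 * q + 5))
      expand = solve-∀
      collect : ∀ c → 25 + 12 * (2 * c) ≡ 1 + (1 + c) * 24
      collect = solve-∀

  power : ∀ p → 6 ∣ p + 1 → ∀ α → ∃[ c ] p ^ (2 * α) ≡ 1 + c * 24
  power p h zero    = 0 , refl
  power p h (suc α) =
    let c , e = square p h
        d , g = power p h α
    in c + d + c * d * 24
     , trans (cong (p ^_) (*-suc 2 α))
         (trans (sym (*-assoc p p (p ^ (2 * α))))
           (trans (cong₂ _*_ e g) (expand c d)))
    where
      expand : ∀ c d → (1 + c * 24) * (1 + d * 24) ≡ 1 + (c + d + c * d * 24) * 24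
      expand = solve-∀

-- For p ≡ -1 (mod 6) and α ≥ 1 the quotient ((24i + 7p) p^(2α-1) - 7) / 24 is
-- a natural number, so truncated subtraction and floor division lose nothing.
exact-quotient : ∀ p → 6 ∣ p + 1 → ∀ α → 1 ≤ α → ∀ i →
  24 * (((24 * i + 7 * p) * p ^ (2 * α ∸ 1) ∸ 7) / 24) + 7 ≡ (24 * i + 7 * p) * p ^ (2 * α ∸ 1)
exact-quotient p h α@(suc a) _ i = trans (cong (λ t → 24 * ((t ∸ 7) / 24) + 7) eq)
  (trans (cong (λ t → 24 * t + 7) (m*n/n≡m m 24)) (trans (swap m) (sym eq)))
  where
    P = p ^ (2 * α ∸ 1)
    c = proj₁ (power p h α)
    m = i * P + 7 * c
    expand : ∀ i p P → (24 * i + 7 * p) * P ≡ 24 * (i * P) + 7 * (p * P)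
    expand = solve-∀
    collect : ∀ t c → 24 * t + 7 * (1 + c * 24) ≡ 7 + (t + 7 * c) * 24
    collect = solve-∀
    swap : ∀ m → 24 * m + 7 ≡ 7 + m * 24
    swap = solve-∀
    eq : (24 * i + 7 * p) * P ≡ 7 + m * 24
    eq = trans (expand i p P)
      (trans (cong (λ t → 24 * (i * P) + 7 * t) (proj₂ (power p h α))) (collect (i * P) c))

{-# OPTIONS --safe #-}

-- Mod 2, writing f_k = ∏(1 - q^(kn)), the generating function f₈/f₁ of b₈ is
-- f₄ · f₁³. By Euler and Gauss, f₄ is supported on four times the pentagonal
-- numbers and f₁³ = ∑ q^(k(k+1)/2) on the triangular numbers. Hence b₈(N) odd
-- forces 24N + 7 = x² + 3y². A prime p ≡ 2 (mod 3) divides such a form to an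
-- even power, whereas it divides 24N + 7 exactly 2α - 1 times for the N in
-- question.
--
-- Euler's and Gauss's identities follow Shanks: a finite sum depending on n
-- agrees with the partial product modulo a high power of q, and equals a
-- partial sum of the theta series because it telescopes in n.
module Submission where

open import Defs
open import Data.Nat using (ℕ; _+_; _*_; _∸_; _^_; _/_; _≤_)
open import Data.Nat.Divisibility using (_∣_)
open import Data.Nat.Primality using (Prime)
open import Algebra.Bundles using (CommutativeRing)
import Algebra.Solver.Ring
open import Algebra.Solver.Ring.AlmostCommutativeRing
  using (fromCommutativeRing; _-Raw-AlmostCommutative⟶_)
import Algebra.Solver.Ring.Simple
open import Data.Fin.Base as Fin using (Fin; toℕ; fromℕ; inject₁)
open import Data.Fin.Properties using (toℕ<n; toℕ-fromℕ; toℕ-inject₁)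
open import Data.List using (List; []; _∷_; _++_; [_]; map; concatMap; upTo; filter; length)
open import Data.List.Properties
  using (concatMap-++; concatMap-cong; filter-++; length-++; filter-accept; filter-reject; ++-identityʳ; upTo-∷ʳ)
open import Data.List.Relation.Unary.All using (_∷_)
open import Data.Maybe.Base using (Maybe; just; nothing)
open import Data.Nat
  using (zero; suc; _!; _<_; _⊓_; z≤n; s≤s; NonZero; nonTrivial⇒n>1; ≢-nonZero⁻¹; >-nonZero; parity)
open import Data.Nat.Combinatorics using (_C_; nCk≡n!/k![n-k]!; k![n∸k]!∣n!; nCn≡1)
open import Data.Nat.Divisibility
open import Data.Nat.DivMod using (m/n*n≡m)
open import Data.Nat.Primality using (euclidsLemma; prime⇒nonZero; prime⇒nonTrivial)
open import Data.Nat.Properties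
open import Data.Nat.Tactic.RingSolver using (solve-∀)
open import Data.Parity.Base as ℙ using (Parity; 0ℙ; 1ℙ)
import Data.Parity.Properties as ℙ
open import Data.Product using (_×_; _,_; proj₁; proj₂; ∃-syntax)
open import Data.Sum using (_⊎_; inj₁; inj₂; [_,_]′)
open import Data.Vec.Functional using (Vector)
open import Function.Base using (_∘_; id)
open import Level using (0ℓ)
open import Relation.Binary.Bundles using (Setoid)
open import Relation.Binary.PropositionalEquality
  using (_≡_; _≗_; refl; sym; trans; cong; cong₂; subst; module ≡-Reasoning)
import Relation.Binary.Reasoning.Setoid
open import Relation.Nullary using (¬_; Dec; yes; no; contradiction)
open import Relation.Nullary.Decidable using (decidable-stable)
open import Algebra.Properties.Monoid.Sum +-0-monoid using (sum; sum-init-last)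
import Algebra.Properties.CommutativeSemiring.Binomial +-*-commutativeSemiring as Binomial
import Algebra.Properties.Semiring.Exp +-*-semiring as Exp
import Algebra.Properties.Semiring.Mult +-*-semiring as Mult

-- Power series mod 2

-- Over `Parity` signs disappear and squaring is additive, so f₈ = f₄². The cube f₁³ is never
-- formed: Gauss's identity is used as f₄ = f₁ · ∑ q^(k(k+1)/2), so f₁ times the series of b₈ is f₈
-- = f₄ · f₄ = f₄ · f₁ · ∑ q^(k(k+1)/2), and f₁ is cancelled. Infinite products are avoided
-- altogether. Every f_k is cut to finitely many factors, and equality is claimed only up to
-- coefficient n, so the number of factors has to be chosen to suit n. The 7 in 24N + 7 is 4 + 3,
-- the amounts that complete the square for four times a pentagonal number and for a triangular
-- number.

module ParitySolver where
  open import Algebra.Solver.Ring.Simple (fromCommutativeRing ℙ.+-*-commutativeRing) ℙ._≟_ public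

Series : Set
Series = ℕ → Parity

constant : Parity → Series
constant c zero    = c
constant c (suc n) = 0ℙ

infixl 6 _⊕_
infixl 7 _⊗_

_⊕_ : Series → Series → Series
(f ⊕ g) n = f n ℙ.+ g n

-- The Cauchy product, unfolded along f = f 0 + X · (f ∘ suc): recursion on the index replaces a sum
-- over i + j = n.
_⊗_ : Series → Series → Series
(f ⊗ g) zero    = f 0 ℙ.* g 0
(f ⊗ g) (suc n) = f 0 ℙ.* g (suc n) ℙ.+ ((f ∘ suc) ⊗ g) n

X : Series
X zero    = 0ℙ
X (suc n) = constant 1ℙ n

⊗-cong : ∀ {f f′ g g′} → f ≗ f′ → g ≗ g′ → f ⊗ g ≗ f′ ⊗ g′
⊗-cong p q zero    = cong₂ ℙ._*_ (p 0) (q 0)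
⊗-cong p q (suc n) = cong₂ ℙ._+_ (cong₂ ℙ._*_ (p 0) (q (suc n))) (⊗-cong (p ∘ suc) q n)

constant-⊗ : ∀ c f → constant c ⊗ f ≗ λ n → c ℙ.* f n
constant-⊗ c f zero    = refl
constant-⊗ c f (suc n) = trans (cong (c ℙ.* f (suc n) ℙ.+_) (zero-⊗ f n)) (ℙ.+-identityʳ _)
  where
  zero-⊗ : ∀ f → (λ _ → 0ℙ) ⊗ f ≗ λ _ → 0ℙ
  zero-⊗ f zero    = refl
  zero-⊗ f (suc n) = zero-⊗ f n

⊗-distribʳ : ∀ h f g → (f ⊕ g) ⊗ h ≗ (f ⊗ h) ⊕ (g ⊗ h)
⊗-distribʳ h f g zero    = ℙ.*-distribʳ-+ (h 0) (f 0) (g 0)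
⊗-distribʳ h f g (suc n) = trans
  (cong ((f 0 ℙ.+ g 0) ℙ.* h (suc n) ℙ.+_) (⊗-distribʳ h (f ∘ suc) (g ∘ suc) n))
  (solve 5 (λ a b c d e → (a :+ b) :* c :+ (d :+ e) := a :* c :+ d :+ (b :* c :+ e)) refl
    (f 0) (g 0) (h (suc n)) (((f ∘ suc) ⊗ h) n) (((g ∘ suc) ⊗ h) n))
  where open ParitySolver

-- The defining recursion peels the left factor; this mirror image peels the right one. It is
-- written with `g 0` in front so that commutativity follows by matching it against the definition
-- of `g ⊗ f`.
⊗-sucʳ : ∀ f g n → (f ⊗ g) (suc n) ≡ g 0 ℙ.* f (suc n) ℙ.+ (f ⊗ (g ∘ suc)) n
⊗-sucʳ f g zero    = solve 4 (λ a b c d → a :* b :+ c :* d := d :* c :+ a :* b) refl (f 0) (g 1) (f 1) (g 0)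
  where open ParitySolver
⊗-sucʳ f g (suc n) = trans
  (cong (f 0 ℙ.* g (suc (suc n)) ℙ.+_) (⊗-sucʳ (f ∘ suc) g n))
  (solve 3 (λ a b c → a :+ (b :+ c) := b :+ (a :+ c)) refl
    (f 0 ℙ.* g (suc (suc n))) (g 0 ℙ.* f (suc (suc n))) (((f ∘ suc) ⊗ (g ∘ suc)) n))
  where open ParitySolver

⊗-comm : ∀ f g → f ⊗ g ≗ g ⊗ f
⊗-comm f g zero    = ℙ.*-comm (f 0) (g 0)
⊗-comm f g (suc n) = trans (⊗-sucʳ f g n)
  (cong (g 0 ℙ.* f (suc n) ℙ.+_) (⊗-comm f (g ∘ suc) n))

⊗-scale : ∀ c f g → (λ n → c ℙ.* f n) ⊗ g ≗ λ n → c ℙ.* (f ⊗ g) n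
⊗-scale c f g zero    = ℙ.*-assoc c (f 0) (g 0)
⊗-scale c f g (suc n) = trans
  (cong (c ℙ.* f 0 ℙ.* g (suc n) ℙ.+_) (⊗-scale c (f ∘ suc) g n))
  (solve 4 (λ a b c d → a :* b :* c :+ a :* d := a :* (b :* c :+ d)) refl c (f 0) (g (suc n)) (((f ∘ suc) ⊗ g) n))
  where open ParitySolver

⊗-assoc : ∀ f g h → (f ⊗ g) ⊗ h ≗ f ⊗ (g ⊗ h)
⊗-assoc f g h zero    = ℙ.*-assoc (f 0) (g 0) (h 0)
⊗-assoc f g h (suc n) = begin
  f 0 ℙ.* g 0 ℙ.* h (suc n) ℙ.+ (((λ k → f 0 ℙ.* g (suc k)) ⊕ ((f ∘ suc) ⊗ g)) ⊗ h) n
    ≡⟨ cong (f 0 ℙ.* g 0 ℙ.* h (suc n) ℙ.+_) (⊗-distribʳ h _ ((f ∘ suc) ⊗ g) n) ⟩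
  f 0 ℙ.* g 0 ℙ.* h (suc n) ℙ.+ (((λ k → f 0 ℙ.* g (suc k)) ⊗ h) n ℙ.+ (((f ∘ suc) ⊗ g) ⊗ h) n)
    ≡⟨ cong (f 0 ℙ.* g 0 ℙ.* h (suc n) ℙ.+_)
         (cong₂ ℙ._+_ (⊗-scale (f 0) (g ∘ suc) h n) (⊗-assoc (f ∘ suc) g h n)) ⟩
  f 0 ℙ.* g 0 ℙ.* h (suc n) ℙ.+ (f 0 ℙ.* ((g ∘ suc) ⊗ h) n ℙ.+ ((f ∘ suc) ⊗ (g ⊗ h)) n)
    ≡⟨ solve 5 (λ a b c d e → a :* b :* c :+ (a :* d :+ e) := a :* (b :* c :+ d) :+ e) refl
         (f 0) (g 0) (h (suc n)) (((g ∘ suc) ⊗ h) n) (((f ∘ suc) ⊗ (g ⊗ h)) n) ⟩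
  f 0 ℙ.* (g ⊗ h) (suc n) ℙ.+ ((f ∘ suc) ⊗ (g ⊗ h)) n ∎
  where
  open ParitySolver
  open ≡-Reasoning

constant-0 : ∀ n → constant 0ℙ n ≡ 0ℙ
constant-0 zero    = refl
constant-0 (suc n) = refl

seriesRing : CommutativeRing 0ℓ 0ℓ
seriesRing = record
  { Carrier = Series
  ; _≈_ = _≗_
  ; _+_ = _⊕_
  ; _*_ = _⊗_
  ; -_ = id
  ; 0# = constant 0ℙ
  ; 1# = constant 1ℙ
  ; isCommutativeRing = record
    { isRing = record
      { +-isAbelianGroup = record
        { isGroup = record
          { isMonoid = record
            { isSemigroup = record
              { isMagma = record
                { isEquivalence = record
                  { refl = λ _ → refl
                  ; sym = λ p n → sym (p n)
                  ; trans = λ p q n → trans (p n) (q n)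
                  }
                ; ∙-cong = λ p q n → cong₂ ℙ._+_ (p n) (q n)
                }
              ; assoc = λ f g h n → ℙ.+-assoc (f n) (g n) (h n)
              }
            ; identity = identityˡ , λ f n → trans (ℙ.+-comm (f n) _) (identityˡ f n)
            }
          ; inverse = inverse , inverse
          ; ⁻¹-cong = id
          }
        ; comm = λ f g n → ℙ.+-comm (f n) (g n)
        }
      ; *-cong = ⊗-cong
      ; *-assoc = ⊗-assoc
      ; *-identity = constant-⊗ 1ℙ , λ f n → trans (⊗-comm f (constant 1ℙ) n) (constant-⊗ 1ℙ f n)
      ; distrib = (λ f g h n → trans (⊗-comm f (g ⊕ h) n) (trans (⊗-distribʳ f g h n)
                    (cong₂ ℙ._+_ (⊗-comm g f n) (⊗-comm h f n))))
                , ⊗-distribʳ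
      }
    ; *-comm = ⊗-comm
    }
  }
  where
  identityˡ : ∀ f → constant 0ℙ ⊕ f ≗ f
  identityˡ f n = cong (ℙ._+ f n) (constant-0 n)
  inverse : ∀ f → f ⊕ f ≗ constant 0ℙ
  inverse f n = trans (ℙ.p+p≡0ℙ (f n)) (sym (constant-0 n))

constant-hom : CommutativeRing.rawRing ℙ.+-*-commutativeRing
                 -Raw-AlmostCommutative⟶ fromCommutativeRing seriesRing
constant-hom = record
  { ⟦_⟧ = constant
  ; +-homo = λ { c d zero → refl ; c d (suc n) → refl }
  ; *-homo = λ { c d n → sym (trans (constant-⊗ c (constant d) n) (scale c d n)) }
  ; -‿homo = λ c n → refl
  ; 0-homo = λ _ → refl
  ; 1-homo = λ _ → refl
  }
  where
  scale : ∀ c d n → c ℙ.* constant d n ≡ constant (c ℙ.* d) n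
  scale c d zero    = refl
  scale c d (suc n) = ℙ.*-zeroʳ c

constant-≟ : ∀ c d → Maybe (constant c ≗ constant d)
constant-≟ c d with c ℙ.≟ d
... | yes refl = just λ _ → refl
... | no _     = nothing

-- Coefficients in Parity let the solver use 1 + 1 = 0.
module SeriesSolver = Algebra.Solver.Ring
  (CommutativeRing.rawRing ℙ.+-*-commutativeRing) (fromCommutativeRing seriesRing) constant-hom constant-≟

open CommutativeRing seriesRing
  using (_≈_; 1#; 0#; setoid; commutativeSemiring; semiring)
  renaming (refl to ≈-refl; sym to ≈-sym; trans to ≈-trans; +-cong to ⊕-cong; +-congˡ to ⊕-congˡ;
            +-congʳ to ⊕-congʳ; *-congˡ to ⊗-congˡ; *-congʳ to ⊗-congʳ)
open import Algebra.Properties.Semiring.Exp semiring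
  using ()
  renaming (_^_ to infixr 8 _^ˢ_; ^-congˡ to ^ˢ-congˡ; ^-congʳ to ^ˢ-congʳ; ^-homo-* to ^ˢ-homo-⊗;
            ^-assocʳ to ^ˢ-assocʳ)
open import Algebra.Properties.CommutativeSemiring.Exp commutativeSemiring
  using () renaming (^-distrib-* to ^ˢ-distrib-⊗)
open SeriesSolver using (solve; _:=_; _:+_; _:*_; con)
module ≈-Reasoning = Relation.Binary.Reasoning.Setoid setoid

-- The identities of Euler and Gauss

triangle : ℕ → ℕ
triangle zero    = 0
triangle (suc n) = suc n + triangle n

product : (ℕ → Series) → ℕ → Series
product a zero    = 1#
product a (suc n) = a n ⊗ product a n

-- The factors 1 - q^k appear as 1 + q^k, the same mod 2. The base `q` is a variable because
-- products in powers of `X` occur and Euler's identity is applied at `X ^ˢ 4`.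
eulerProduct : Series → ℕ → Series
eulerProduct q = product λ r → 1# ⊕ q ^ˢ suc r

oddProduct : Series → ℕ → Series
oddProduct q = product λ r → 1# ⊕ q ^ˢ suc (2 * r)

-- With m = n + 1, the two new exponents are m(3m - 1)/2 and m(3m + 1)/2.
pentagonalSum : Series → ℕ → Series
pentagonalSum q zero    = 1#
pentagonalSum q (suc n) = pentagonalSum q n
  ⊕ q ^ˢ (triangle (suc n) + n * suc n) ⊕ q ^ˢ (triangle (suc n) + suc n * suc n)

triangularSum : Series → ℕ → Series
triangularSum q zero    = 1#
triangularSum q (suc n) = triangularSum q n ⊕ q ^ˢ triangle (suc n)

-- ∑_{s ≤ r} (∏_{s ≤ k < r} a k) c (s - 1) z^s, where the s = 0 term has coefficient
-- ∏_{k < r} a k.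
hornerSum : (ℕ → Series) → (ℕ → Series) → Series → ℕ → Series
hornerSum a c z zero    = 1#
hornerSum a c z (suc r) = a r ⊗ hornerSum a c z r ⊕ c r ⊗ z ^ˢ suc r

hornerSum-cong : ∀ a c {z z′} r → z ≈ z′ → hornerSum a c z r ≈ hornerSum a c z′ r
hornerSum-cong a c zero    p = ≈-refl
hornerSum-cong a c (suc r) p =
  ⊕-cong (⊗-congˡ {a r} (hornerSum-cong a c r p)) (⊗-congˡ {c r} (^ˢ-congˡ (suc r) p))

-- Gauss's telescoping produces (q^(2n+1))^(n+1) and (q^(2n+3))^(n+1). Together with `triangle-even`
-- this recognises their exponents as consecutive triangular numbers.
triangle-odd : ∀ n → triangle (suc (2 * n)) ≡ suc (2 * n) * suc n
triangle-odd zero    = refl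
triangle-odd (suc n) = trans (cong (triangle ∘ suc) (*-suc 2 n))
  (trans (cong (λ t → suc (suc (suc (2 * n))) + (suc (suc (2 * n)) + t)) (triangle-odd n)) (arithmetic n))
  where
  arithmetic : ∀ n → suc (suc (suc (2 * n))) + (suc (suc (2 * n)) + suc (2 * n) * suc n) ≡ suc (2 * suc n) * suc (suc n)
  arithmetic = solve-∀

triangle-even : ∀ n → triangle (2 * suc n) ≡ suc (2 * suc n) * suc n
triangle-even n = trans (cong triangle (*-suc 2 n))
  (trans (cong (suc (suc (2 * n)) +_) (triangle-odd n)) (arithmetic n))
  where
  arithmetic : ∀ n → suc (suc (2 * n)) + suc (2 * n) * suc n ≡ suc (2 * suc n) * suc n
  arithmetic = solve-∀

module _ (q : Series) where

  eulerSum : Series → ℕ → Series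
  eulerSum = hornerSum (λ r → 1# ⊕ q ^ˢ suc r) (λ r → q ^ˢ triangle (suc r))

  -- Shanks sums (P_r / P_s) z^s with P_r = ∏ (1 - q^(2k)) / (1 - q^(2k-1)) over k ≤ r. Here that
  -- sum is multiplied by `oddProduct q r`, which clears all denominators and accounts for the extra
  -- factor in `gaussSum≈triangularSum`.
  gaussSum : Series → ℕ → Series
  gaussSum = hornerSum (λ r → 1# ⊕ (q ^ˢ 2) ^ˢ suc r) (λ r → oddProduct q (suc r))

  -- Shanks' telescoping step from n to n + 1, with q^n replaced by a free z so
  -- that it can be proved by induction on the number of terms.
  eulerSum-shift : ∀ z r →
    (1# ⊕ q ⊗ z) ⊗ eulerSum (q ⊗ z) r ≈ eulerSum z r ⊕ q ^ˢ triangle (suc r) ⊗ z ^ˢ suc r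
  eulerSum-shift z zero = solve 2 (λ q z → (con 1ℙ :+ q :* z) :* con 1ℙ
    := con 1ℙ :+ q :* con 1ℙ :* (z :* con 1ℙ)) ≈-refl q z
  eulerSum-shift z (suc r) = begin
    (1# ⊕ q ⊗ z) ⊗ ((1# ⊕ y) ⊗ eulerSum (q ⊗ z) r ⊕ t ⊗ (q ⊗ z) ^ˢ suc r)
      ≈⟨ ⊗-congˡ {1# ⊕ q ⊗ z} (⊕-congˡ {(1# ⊕ y) ⊗ eulerSum (q ⊗ z) r}
           (⊗-congˡ {t} (^ˢ-distrib-⊗ q z (suc r)))) ⟩
    (1# ⊕ q ⊗ z) ⊗ ((1# ⊕ y) ⊗ eulerSum (q ⊗ z) r ⊕ t ⊗ (y ⊗ w))
      ≈⟨ solve 6 (λ q z y k t w → (con 1ℙ :+ q :* z) :* ((con 1ℙ :+ y) :* k :+ t :* (y :* w))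
           := (con 1ℙ :+ y) :* ((con 1ℙ :+ q :* z) :* k) :+ (con 1ℙ :+ q :* z) :* (t :* (y :* w)))
           ≈-refl q z y (eulerSum (q ⊗ z) r) t w ⟩
    (1# ⊕ y) ⊗ ((1# ⊕ q ⊗ z) ⊗ eulerSum (q ⊗ z) r) ⊕ (1# ⊕ q ⊗ z) ⊗ (t ⊗ (y ⊗ w))
      ≈⟨ ⊕-congʳ {(1# ⊕ q ⊗ z) ⊗ (t ⊗ (y ⊗ w))} (⊗-congˡ {1# ⊕ y} (eulerSum-shift z r)) ⟩
    (1# ⊕ y) ⊗ (eulerSum z r ⊕ t ⊗ w) ⊕ (1# ⊕ q ⊗ z) ⊗ (t ⊗ (y ⊗ w))
      -- The product t · y · w arises twice and cancels mod 2. What survives is the new summand t ·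
      -- w and the next boundary term, as T(r+2) = (r+2) + T(r+1) for triangular numbers T.
      ≈⟨ solve 6 (λ q z y k t w → (con 1ℙ :+ y) :* (k :+ t :* w) :+ (con 1ℙ :+ q :* z) :* (t :* (y :* w))
           := (con 1ℙ :+ y) :* k :+ t :* w :+ ((q :* y) :* t) :* (z :* w))
           ≈-refl q z y (eulerSum z r) t w ⟩
    (1# ⊕ y) ⊗ eulerSum z r ⊕ t ⊗ w ⊕ ((q ⊗ y) ⊗ t) ⊗ (z ⊗ w)
      ≈⟨ ⊕-congˡ {eulerSum z (suc r)} (⊗-congʳ {z ⊗ w} (^ˢ-homo-⊗ q (suc (suc r)) (triangle (suc r)))) ⟨
    eulerSum z (suc r) ⊕ q ^ˢ triangle (suc (suc r)) ⊗ z ^ˢ suc (suc r) ∎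
    where
    open ≈-Reasoning
    y = q ^ˢ suc r
    t = q ^ˢ triangle (suc r)
    w = z ^ˢ suc r

  -- At z = q^(2n+1), q²z is the argument belonging to n + 1, 1 + qz is the factor that `gaussSum`
  -- prefixes at that step, and 1 + z is the new factor of `oddProduct`.
  gaussSum-shift : ∀ z r →
    (1# ⊕ q ⊗ z) ⊗ gaussSum (q ^ˢ 2 ⊗ z) r ≈ (1# ⊕ z) ⊗ gaussSum z r ⊕ oddProduct q (suc r) ⊗ z ^ˢ suc r
  gaussSum-shift z zero = solve 2 (λ q z → (con 1ℙ :+ q :* z) :* con 1ℙ
    := (con 1ℙ :+ z) :* con 1ℙ :+ ((con 1ℙ :+ q :* con 1ℙ) :* con 1ℙ) :* (z :* con 1ℙ)) ≈-refl q z
  gaussSum-shift z (suc r) = begin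
    (1# ⊕ q ⊗ z) ⊗ ((1# ⊕ y) ⊗ gaussSum (q ^ˢ 2 ⊗ z) r ⊕ u ⊗ (q ^ˢ 2 ⊗ z) ^ˢ suc r)
      ≈⟨ ⊗-congˡ {1# ⊕ q ⊗ z} (⊕-congˡ {(1# ⊕ y) ⊗ gaussSum (q ^ˢ 2 ⊗ z) r}
           (⊗-congˡ {u} (^ˢ-distrib-⊗ (q ^ˢ 2) z (suc r)))) ⟩
    (1# ⊕ q ⊗ z) ⊗ ((1# ⊕ y) ⊗ gaussSum (q ^ˢ 2 ⊗ z) r ⊕ u ⊗ (y ⊗ w))
      ≈⟨ solve 6 (λ q z y k t w → (con 1ℙ :+ q :* z) :* ((con 1ℙ :+ y) :* k :+ t :* (y :* w))
           := (con 1ℙ :+ y) :* ((con 1ℙ :+ q :* z) :* k) :+ (con 1ℙ :+ q :* z) :* (t :* (y :* w)))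
           ≈-refl q z y (gaussSum (q ^ˢ 2 ⊗ z) r) u w ⟩
    (1# ⊕ y) ⊗ ((1# ⊕ q ⊗ z) ⊗ gaussSum (q ^ˢ 2 ⊗ z) r) ⊕ (1# ⊕ q ⊗ z) ⊗ (u ⊗ (y ⊗ w))
      ≈⟨ ⊕-congʳ {(1# ⊕ q ⊗ z) ⊗ (u ⊗ (y ⊗ w))} (⊗-congˡ {1# ⊕ y} (gaussSum-shift z r)) ⟩
    (1# ⊕ y) ⊗ ((1# ⊕ z) ⊗ gaussSum z r ⊕ u ⊗ w) ⊕ (1# ⊕ q ⊗ z) ⊗ (u ⊗ (y ⊗ w))
      ≈⟨ solve 6 (λ q z y k u w → (con 1ℙ :+ y) :* ((con 1ℙ :+ z) :* k :+ u :* w)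
             :+ (con 1ℙ :+ q :* z) :* (u :* (y :* w))
           := (con 1ℙ :+ z) :* ((con 1ℙ :+ y) :* k :+ u :* w) :+ ((con 1ℙ :+ q :* y) :* u) :* (z :* w))
           ≈-refl q z y (gaussSum z r) u w ⟩
    (1# ⊕ z) ⊗ ((1# ⊕ y) ⊗ gaussSum z r ⊕ u ⊗ w) ⊕ ((1# ⊕ q ⊗ y) ⊗ u) ⊗ (z ⊗ w)
      ≈⟨ ⊕-congˡ {(1# ⊕ z) ⊗ gaussSum z (suc r)}
           (⊗-congʳ {z ⊗ w} (⊗-congʳ {u} (⊕-congˡ {1#} (⊗-congˡ {q} (^ˢ-assocʳ q 2 (suc r)))))) ⟩
    (1# ⊕ z) ⊗ gaussSum z (suc r) ⊕ oddProduct q (suc (suc r)) ⊗ z ^ˢ suc (suc r) ∎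
    where
    open ≈-Reasoning
    y = (q ^ˢ 2) ^ˢ suc r
    u = oddProduct q (suc r)
    w = z ^ˢ suc r

  -- Each step adds two terms: the boundary term of the shift, with exponent T(n+1) + n(n+1), and
  -- the new top summand, with exponent T(n+1) + (n+1)². Hence the shape of the exponents in
  -- `pentagonalSum`.
  eulerSum≈pentagonalSum : ∀ n → eulerSum (q ^ˢ n) n ≈ pentagonalSum q n
  eulerSum≈pentagonalSum zero    = ≈-refl
  eulerSum≈pentagonalSum (suc n) = begin
    (1# ⊕ q ^ˢ suc n) ⊗ eulerSum (q ^ˢ suc n) n ⊕ t ⊗ (q ^ˢ suc n) ^ˢ suc n
      ≈⟨ ⊕-cong (eulerSum-shift (q ^ˢ n) n) (⊗-congˡ {t} (^ˢ-assocʳ q (suc n) (suc n))) ⟩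
    eulerSum (q ^ˢ n) n ⊕ t ⊗ (q ^ˢ n) ^ˢ suc n ⊕ t ⊗ q ^ˢ (suc n * suc n)
      ≈⟨ ⊕-congʳ {t ⊗ q ^ˢ (suc n * suc n)} (⊕-cong (eulerSum≈pentagonalSum n) (⊗-congˡ {t} (^ˢ-assocʳ q n (suc n)))) ⟩
    pentagonalSum q n ⊕ t ⊗ q ^ˢ (n * suc n) ⊕ t ⊗ q ^ˢ (suc n * suc n)
      ≈⟨ ⊕-cong (⊕-congˡ {pentagonalSum q n} (^ˢ-homo-⊗ q (triangle (suc n)) (n * suc n)))
           (^ˢ-homo-⊗ q (triangle (suc n)) (suc n * suc n)) ⟨
    pentagonalSum q (suc n) ∎
    where
    open ≈-Reasoning
    t = q ^ˢ triangle (suc n)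

  gaussSum≈triangularSum : ∀ n → gaussSum (q ^ˢ suc (2 * n)) n ≈ oddProduct q n ⊗ triangularSum q (2 * n)
  gaussSum≈triangularSum zero    = solve 0 (con 1ℙ := con 1ℙ :* con 1ℙ) ≈-refl
  gaussSum≈triangularSum (suc n) = begin
    (1# ⊕ (q ^ˢ 2) ^ˢ suc n) ⊗ gaussSum (q ^ˢ suc (2 * suc n)) n ⊕ u ⊗ (q ^ˢ suc (2 * suc n)) ^ˢ suc n
      ≈⟨ ⊕-cong (⊗-cong (⊕-congˡ {1#} (≈-trans (^ˢ-assocʳ q 2 (suc n)) step₁)) (hornerSum-cong _ _ n step₂))
           (⊗-congˡ {u} (^ˢ-assocʳ q (suc (2 * suc n)) (suc n))) ⟩
    (1# ⊕ q ⊗ z) ⊗ gaussSum (q ^ˢ 2 ⊗ z) n ⊕ u ⊗ q ^ˢ (suc (2 * suc n) * suc n)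
      ≈⟨ ⊕-congʳ {u ⊗ q ^ˢ (suc (2 * suc n) * suc n)} (gaussSum-shift z n) ⟩
    (1# ⊕ z) ⊗ gaussSum z n ⊕ u ⊗ z ^ˢ suc n ⊕ u ⊗ q ^ˢ (suc (2 * suc n) * suc n)
      ≈⟨ ⊕-cong (⊕-cong (⊗-congˡ {1# ⊕ z} (gaussSum≈triangularSum n)) (⊗-congˡ {u} (^ˢ-assocʳ q (suc (2 * n)) (suc n))))
           (⊗-congˡ {u} (^ˢ-congʳ q (sym (trans (cong triangle (sym (*-suc 2 n))) (triangle-even n))))) ⟩
    (1# ⊕ z) ⊗ (oddProduct q n ⊗ triangularSum q (2 * n)) ⊕ u ⊗ q ^ˢ (suc (2 * n) * suc n)
      ⊕ u ⊗ q ^ˢ triangle (2 + 2 * n)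
      ≈⟨ ⊕-congʳ {u ⊗ q ^ˢ triangle (2 + 2 * n)} (⊕-congˡ {(1# ⊕ z) ⊗ (oddProduct q n ⊗ triangularSum q (2 * n))}
           (⊗-congˡ {u} (^ˢ-congʳ q (sym (triangle-odd n))))) ⟩
    (1# ⊕ z) ⊗ (oddProduct q n ⊗ triangularSum q (2 * n)) ⊕ u ⊗ q ^ˢ triangle (1 + 2 * n)
      ⊕ u ⊗ q ^ˢ triangle (2 + 2 * n)
      ≈⟨ solve 5 (λ z o s a b → (con 1ℙ :+ z) :* (o :* s) :+ (con 1ℙ :+ z) :* o :* a :+ (con 1ℙ :+ z) :* o :* b
           := (con 1ℙ :+ z) :* o :* (s :+ a :+ b))
           ≈-refl z (oddProduct q n) (triangularSum q (2 * n)) (q ^ˢ triangle (1 + 2 * n)) (q ^ˢ triangle (2 + 2 * n)) ⟩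
    u ⊗ triangularSum q (2 + 2 * n)
      ≡⟨ cong (λ k → u ⊗ triangularSum q k) (*-suc 2 n) ⟨
    u ⊗ triangularSum q (2 * suc n) ∎
    where
    open ≈-Reasoning
    z = q ^ˢ suc (2 * n)
    u = oddProduct q (suc n)
    step₁ : q ^ˢ (2 * suc n) ≈ q ⊗ z
    step₁ = ^ˢ-congʳ q (*-suc 2 n)
    step₂ : q ^ˢ suc (2 * suc n) ≈ q ^ˢ 2 ⊗ z
    step₂ = ≈-trans (⊗-congˡ {q} step₁) (solve 2 (λ q z → q :* (q :* z) := q :* (q :* con 1ℙ) :* z) ≈-refl q z)

-- Congruence modulo X^(n+1) and the finite forms of Euler's and Gauss's identities

infix 4 _≈[_]_
_≈[_]_ : Series → ℕ → Series → Set
f ≈[ n ] g = ∀ k → k ≤ n → f k ≡ g k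

truncated : ℕ → Setoid 0ℓ 0ℓ
truncated n = record
  { Carrier = Series
  ; _≈_ = _≈[ n ]_
  ; isEquivalence = record
    { refl = λ _ _ → refl
    ; sym = λ p k k≤n → sym (p k k≤n)
    ; trans = λ p q k k≤n → trans (p k k≤n) (q k k≤n)
    }
  }

≈⇒≈[] : ∀ {n f g} → f ≈ g → f ≈[ n ] g
≈⇒≈[] p k _ = p k

⊗-cong-[] : ∀ {n f f′ g g′} → f ≈[ n ] f′ → g ≈[ n ] g′ → f ⊗ g ≈[ n ] f′ ⊗ g′
⊗-cong-[] p q zero    0≤n = cong₂ ℙ._*_ (p 0 0≤n) (q 0 0≤n)
⊗-cong-[] p q (suc k) (s≤s k≤n) = cong₂ ℙ._+_ (cong₂ ℙ._*_ (p 0 z≤n) (q (suc k) (s≤s k≤n)))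
  (⊗-cong-[] (λ j j≤n → p (suc j) (s≤s j≤n)) (λ j j≤n → q j (m≤n⇒m≤1+n j≤n)) k k≤n)

-- Replaces the construction of 1/f. Coefficient 0 gives g 0 = h 0; removing that contribution by
-- `⊗-sucʳ` leaves the same hypothesis for the tails, one coefficient shorter.
⊗-cancelˡ-[] : ∀ {n} f {g h} → f 0 ≡ 1ℙ → f ⊗ g ≈[ n ] f ⊗ h → g ≈[ n ] h
⊗-cancelˡ-[] f {g} {h} f₀ p zero 0≤n =
  trans (cong (ℙ._* g 0) (sym f₀)) (trans (p 0 0≤n) (cong (ℙ._* h 0) f₀))
⊗-cancelˡ-[] {suc n} f {g} {h} f₀ p (suc k) (s≤s k≤n) = ⊗-cancelˡ-[] f f₀ tail k k≤n
  where
  g₀≡h₀ : g 0 ≡ h 0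
  g₀≡h₀ = ⊗-cancelˡ-[] f {g} {h} f₀ p 0 z≤n
  tail : f ⊗ (g ∘ suc) ≈[ n ] f ⊗ (h ∘ suc)
  tail j j≤n = ℙ.+-cancelˡ-≡ (g 0 ℙ.* f (suc j)) _ _ (begin
    g 0 ℙ.* f (suc j) ℙ.+ (f ⊗ (g ∘ suc)) j ≡⟨ ⊗-sucʳ f g j ⟨
    (f ⊗ g) (suc j)                         ≡⟨ p (suc j) (s≤s j≤n) ⟩
    (f ⊗ h) (suc j)                         ≡⟨ ⊗-sucʳ f h j ⟩
    h 0 ℙ.* f (suc j) ℙ.+ (f ⊗ (h ∘ suc)) j ≡⟨ cong (λ c → c ℙ.* f (suc j) ℙ.+ (f ⊗ (h ∘ suc)) j) g₀≡h₀ ⟨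
    g 0 ℙ.* f (suc j) ℙ.+ (f ⊗ (h ∘ suc)) j ∎)
    where open ≡-Reasoning

X-⊗-suc : ∀ f n → (X ⊗ f) (suc n) ≡ f n
X-⊗-suc f = constant-⊗ 1ℙ f

X^-⊗-< : ∀ k f {n} → n < k → (X ^ˢ k ⊗ f) n ≡ 0ℙ
X^-⊗-< (suc k) f {zero}  _         = refl
X^-⊗-< (suc k) f {suc n} (s≤s n<k) =
  trans (⊗-assoc X (X ^ˢ k) f (suc n)) (trans (X-⊗-suc (X ^ˢ k ⊗ f) n) (X^-⊗-< k f n<k))

X^-⊗-+ : ∀ k f n → (X ^ˢ k ⊗ f) (k + n) ≡ f n
X^-⊗-+ zero    f n = constant-⊗ 1ℙ f n
X^-⊗-+ (suc k) f n =
  trans (⊗-assoc X (X ^ˢ k) f (suc (k + n))) (trans (X-⊗-suc (X ^ˢ k ⊗ f) (k + n)) (X^-⊗-+ k f n))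

X^-≈[] : ∀ {n k f g h} → n < k → f ≈ g ⊕ X ^ˢ k ⊗ h → f ≈[ n ] g
X^-≈[] {n} {k} {f} {g} {h} n<k p j j≤n = begin
  f j                       ≡⟨ p j ⟩
  g j ℙ.+ (X ^ˢ k ⊗ h) j    ≡⟨ cong (g j ℙ.+_) (X^-⊗-< k h (≤-<-trans j≤n n<k)) ⟩
  g j ℙ.+ 0ℙ                ≡⟨ ℙ.+-identityʳ (g j) ⟩
  g j                       ∎
  where open ≡-Reasoning

-- Every summand except s = 0 carries a factor z. With z a high power of q, the telescoped sum is
-- therefore congruent to the bare product.
hornerSum-mod : ∀ a c z r → ∃[ h ] hornerSum a c z r ≈ product a r ⊕ z ⊗ h
hornerSum-mod a c z zero    = 0# , solve 1 (λ z → con 1ℙ := con 1ℙ :+ z :* con 0ℙ) ≈-refl z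
hornerSum-mod a c z (suc r) with h , p ← hornerSum-mod a c z r =
  a r ⊗ h ⊕ c r ⊗ z ^ˢ r ,
  ≈-trans (⊕-congʳ {c r ⊗ z ^ˢ suc r} (⊗-congˡ {a r} p))
    (solve 6 (λ a p z h c w → a :* (p :+ z :* h) :+ c :* (z :* w) := a :* p :+ z :* (a :* h :+ c :* w)) ≈-refl
      (a r) (product a r) z h (c r) (z ^ˢ r))

eulerProduct-mod : ∀ q m j → ∃[ h ] eulerProduct q (j + m) ≈ eulerProduct q m ⊕ q ^ˢ m ⊗ h
eulerProduct-mod q m zero    = 0# , solve 2 (λ p z → p := p :+ z :* con 0ℙ) ≈-refl (eulerProduct q m) (q ^ˢ m)
eulerProduct-mod q m (suc j) with h , p ← eulerProduct-mod q m j =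
  h ⊕ q ^ˢ suc j ⊗ (eulerProduct q m ⊕ q ^ˢ m ⊗ h) ,
  ≈-trans (⊗-cong (⊕-congˡ {1#} (^ˢ-homo-⊗ q (suc j) m)) p)
    (solve 4 (λ x z p h → (con 1ℙ :+ x :* z) :* (p :+ z :* h) := p :+ z :* (h :+ x :* (p :+ z :* h))) ≈-refl
      (q ^ˢ suc j) (q ^ˢ m) (eulerProduct q m) h)

product-cong : ∀ {a a′} → (∀ r → a r ≈ a′ r) → ∀ n → product a n ≈ product a′ n
product-cong p zero    = ≈-refl
product-cong p (suc n) = ⊗-cong (p n) (product-cong p n)

eulerProduct-cong : ∀ {q q′} → q ≈ q′ → ∀ n → eulerProduct q n ≈ eulerProduct q′ n
eulerProduct-cong p = product-cong λ r → ⊕-congˡ {1#} (^ˢ-congˡ (suc r) p)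

-- (1 + y)² = 1 + y² in characteristic 2, factor by factor.
eulerProduct-square : ∀ q n → eulerProduct (q ^ˢ 2) n ≈ eulerProduct q n ⊗ eulerProduct q n
eulerProduct-square q zero    = solve 0 (con 1ℙ := con 1ℙ :* con 1ℙ) ≈-refl
eulerProduct-square q (suc n) = begin
  (1# ⊕ (q ^ˢ 2) ^ˢ suc n) ⊗ eulerProduct (q ^ˢ 2) n
    ≈⟨ ⊗-cong (⊕-congˡ {1#} (≈-trans (^ˢ-assocʳ q 2 (suc n))
         (≈-trans (^ˢ-congʳ q (cong (suc n +_) (+-identityʳ (suc n)))) (^ˢ-homo-⊗ q (suc n) (suc n)))))
         (eulerProduct-square q n) ⟩
  (1# ⊕ y ⊗ y) ⊗ (eulerProduct q n ⊗ eulerProduct q n)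
    ≈⟨ solve 2 (λ y p → (con 1ℙ :+ y :* y) :* (p :* p) := (con 1ℙ :+ y) :* p :* ((con 1ℙ :+ y) :* p))
         ≈-refl y (eulerProduct q n) ⟩
  eulerProduct q (suc n) ⊗ eulerProduct q (suc n) ∎
  where
  open ≈-Reasoning
  y = q ^ˢ suc n

eulerProduct-even-odd : ∀ q n → eulerProduct q (2 * n) ≈ oddProduct q n ⊗ eulerProduct (q ^ˢ 2) n
eulerProduct-even-odd q zero    = solve 0 (con 1ℙ := con 1ℙ :* con 1ℙ) ≈-refl
eulerProduct-even-odd q (suc n) = begin
  eulerProduct q (2 * suc n)
    ≡⟨ cong (eulerProduct q) (*-suc 2 n) ⟩
  (1# ⊕ q ^ˢ (2 + 2 * n)) ⊗ ((1# ⊕ q ^ˢ suc (2 * n)) ⊗ eulerProduct q (2 * n))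
    ≈⟨ ⊗-cong (⊕-congˡ {1#} (≈-trans (^ˢ-congʳ q (sym (*-suc 2 n))) (≈-sym (^ˢ-assocʳ q 2 (suc n)))))
         (⊗-congˡ {1# ⊕ q ^ˢ suc (2 * n)} (eulerProduct-even-odd q n)) ⟩
  (1# ⊕ (q ^ˢ 2) ^ˢ suc n) ⊗ ((1# ⊕ q ^ˢ suc (2 * n)) ⊗ (oddProduct q n ⊗ eulerProduct (q ^ˢ 2) n))
    ≈⟨ solve 4 (λ a b c d → a :* (b :* (c :* d)) := b :* c :* (a :* d)) ≈-refl
         (1# ⊕ (q ^ˢ 2) ^ˢ suc n) (1# ⊕ q ^ˢ suc (2 * n)) (oddProduct q n) (eulerProduct (q ^ˢ 2) n) ⟩
  oddProduct q (suc n) ⊗ eulerProduct (q ^ˢ 2) (suc n) ∎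
  where open ≈-Reasoning

eulerProduct-X-0 : ∀ n → eulerProduct X n 0 ≡ 1ℙ
eulerProduct-X-0 zero    = refl
eulerProduct-X-0 (suc n) = eulerProduct-X-0 n

euler-pentagonal : ∀ q n → ∃[ h ] pentagonalSum q n ≈ eulerProduct q n ⊕ q ^ˢ n ⊗ h
euler-pentagonal q n with h , p ←
  hornerSum-mod (λ r → 1# ⊕ q ^ˢ suc r) (λ r → q ^ˢ triangle (suc r)) (q ^ˢ n) n =
  h , ≈-trans (≈-sym (eulerSum≈pentagonalSum q n)) p

-- As ∏(1 - q^(4k)) = ∏(1 - q^k)⁴ mod 2, this says ∑ q^(k(k+1)/2) = ∏(1 - q^k)³.
gauss-triangular : ∀ n → eulerProduct X (2 * n) ⊗ triangularSum X (2 * n) ≈[ 2 * n ] eulerProduct (X ^ˢ 4) n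
gauss-triangular n with h , p ←
  hornerSum-mod (λ r → 1# ⊕ (X ^ˢ 2) ^ˢ suc r) (λ r → oddProduct X (suc r)) (X ^ˢ suc (2 * n)) n =
  begin
  eulerProduct X (2 * n) ⊗ T
    ≈⟨ ≈⇒≈[] (⊗-congʳ {T} (eulerProduct-even-odd X n)) ⟩
  oddProduct X n ⊗ V ⊗ T
    ≈⟨ ≈⇒≈[] (solve 3 (λ u v t → u :* v :* t := v :* (u :* t)) ≈-refl (oddProduct X n) V T) ⟩
  V ⊗ (oddProduct X n ⊗ T)
    -- The only inexact step: at z = X^(2n+1) the Gauss sum differs from its s = 0 term, which is V,
    -- only in degrees above 2n.
    ≈⟨ ⊗-cong-[] {f = V} (λ _ _ → refl) (X^-≈[] (n<1+n (2 * n)) (≈-trans (≈-sym (gaussSum≈triangularSum X n)) p)) ⟩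
  V ⊗ V
    ≈⟨ ≈⇒≈[] (eulerProduct-square (X ^ˢ 2) n) ⟨
  eulerProduct ((X ^ˢ 2) ^ˢ 2) n
    ≈⟨ ≈⇒≈[] (eulerProduct-cong (^ˢ-assocʳ X 2 2) n) ⟩
  eulerProduct (X ^ˢ 4) n ∎
  where
  open Relation.Binary.Reasoning.Setoid (truncated (2 * n))
  T = triangularSum X (2 * n)
  V = eulerProduct (X ^ˢ 2) n

-- The generating function of ℓ-regular partitions

partitions≤-fuel : ∀ f g k n → n ≤ f → n ≤ g → partitions≤ f k n ≡ partitions≤ g k n
partitions≤-fuel zero    zero    k zero    _ _ = refl
partitions≤-fuel zero    (suc g) k zero    _ _ = refl
partitions≤-fuel (suc f) zero    k zero    _ _ = refl
partitions≤-fuel (suc f) (suc g) k zero    _ _ = refl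
partitions≤-fuel (suc f) (suc g) k (suc n) (s≤s n≤f) (s≤s n≤g) = concatMap-cong
  (λ j → cong (map (suc j ∷_))
    (partitions≤-fuel f g (suc j) (n ∸ j) (≤-trans (m∸n≤m n j) n≤f) (≤-trans (m∸n≤m n j) n≤g)))
  (upTo (k ⊓ suc n))

partitions≤-saturated : ∀ f k n → n ≤ k → partitions≤ f k n ≡ partitions≤ f n n
partitions≤-saturated f       k zero    _   = trans (zero-case f k) (sym (zero-case f 0))
  where
  zero-case : ∀ f k → partitions≤ f k 0 ≡ [] ∷ []
  zero-case zero    k = refl
  zero-case (suc f) k = refl
partitions≤-saturated zero    k (suc n) _   = refl
partitions≤-saturated (suc f) k (suc n) n<k =
  cong (λ m → concatMap (λ j → map (suc j ∷_) (partitions≤ f (suc j) (n ∸ j))) (upTo m))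
    (trans (m≥n⇒m⊓n≡n n<k) (sym (⊓-idem (suc n))))

-- The enumeration is indexed by the largest part, so raising the bound appends one block, the
-- partitions with largest part k + 1. This recurrence is the source of the factor 1/(1 - q^(k+1)).
partitions≤-suc : ∀ f k n → k ≤ n → partitions≤ (suc f) (suc k) (suc n) ≡
  partitions≤ (suc f) k (suc n) ++ map (suc k ∷_) (partitions≤ f (suc k) (n ∸ k))
partitions≤-suc f k n k≤n = begin
  concatMap g (upTo (suc (k ⊓ n)))     ≡⟨ cong (concatMap g ∘ upTo ∘ suc) (m≤n⇒m⊓n≡m k≤n) ⟩
  concatMap g (upTo (suc k))           ≡⟨ cong (concatMap g) (upTo-∷ʳ k) ⟨
  concatMap g (upTo k ++ [ k ])        ≡⟨ concatMap-++ g (upTo k) [ k ] ⟩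
  concatMap g (upTo k) ++ (g k ++ [])  ≡⟨ cong₂ _++_ (cong (concatMap g ∘ upTo)
    (sym (m≤n⇒m⊓n≡m (m≤n⇒m≤1+n k≤n)))) (++-identityʳ (g k)) ⟩
  partitions≤ (suc f) k (suc n) ++ g k ∎
  where
  open ≡-Reasoning
  g = λ j → map (suc j ∷_) (partitions≤ f (suc j) (n ∸ j))

module _ (ℓ : ℕ) where

  countRegular : List (List ℕ) → ℕ
  countRegular xss = length (filter (isRegular? ℓ) xss)

  countRegular-++ : ∀ xss yss → countRegular (xss ++ yss) ≡ countRegular xss + countRegular yss
  countRegular-++ xss yss = trans (cong length (filter-++ (isRegular? ℓ) xss yss))
    (length-++ (filter (isRegular? ℓ) xss))

  countRegular-accept : ∀ xs xss → IsRegular ℓ xs → countRegular (xs ∷ xss) ≡ suc (countRegular xss)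
  countRegular-accept xs xss r = cong length (filter-accept (isRegular? ℓ) {xs} {xss} r)

  countRegular-reject : ∀ xs xss → ¬ IsRegular ℓ xs → countRegular (xs ∷ xss) ≡ countRegular xss
  countRegular-reject xs xss ¬r = cong length (filter-reject (isRegular? ℓ) {xs} {xss} ¬r)

  countRegular-∷-∣ : ∀ {x} → ℓ ∣ x → ∀ xss → countRegular (map (x ∷_) xss) ≡ 0
  countRegular-∷-∣ ℓ∣x []         = refl
  countRegular-∷-∣ {x} ℓ∣x (xs ∷ xss) = trans
    (countRegular-reject (x ∷ xs) (map (x ∷_) xss) λ { (ℓ∤x ∷ _) → ℓ∤x ℓ∣x })
    (countRegular-∷-∣ ℓ∣x xss)

  countRegular-∷-∤ : ∀ {x} → ¬ ℓ ∣ x → ∀ xss → countRegular (map (x ∷_) xss) ≡ countRegular xss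
  countRegular-∷-∤ ℓ∤x []         = refl
  countRegular-∷-∤ {x} ℓ∤x (xs ∷ xss) = compare (isRegular? ℓ xs)
    where
    compare : Dec (IsRegular ℓ xs) → countRegular (map (x ∷_) (xs ∷ xss)) ≡ countRegular (xs ∷ xss)
    compare (yes r) = trans (countRegular-accept (x ∷ xs) (map (x ∷_) xss) (ℓ∤x ∷ r))
      (trans (cong suc (countRegular-∷-∤ ℓ∤x xss)) (sym (countRegular-accept xs xss r)))
    compare (no ¬r) = trans (countRegular-reject (x ∷ xs) (map (x ∷_) xss) (λ { (_ ∷ r) → ¬r r }))
      (trans (countRegular-∷-∤ ℓ∤x xss) (sym (countRegular-reject xs xss ¬r)))

  regularCount : ℕ → ℕ → ℕ
  regularCount k n = countRegular (partitions≤ n k n)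

  regularCount-saturated : ∀ {k n} → n ≤ k → regularCount k n ≡ b ℓ n
  regularCount-saturated {k} {n} n≤k = cong countRegular (partitions≤-saturated n k n n≤k)

  regularCount-< : ∀ k n → n ≤ k → regularCount (suc k) n ≡ regularCount k n
  regularCount-< k n n≤k = trans (regularCount-saturated (m≤n⇒m≤1+n n≤k)) (sym (regularCount-saturated n≤k))

  regularCount-split : ∀ k n → regularCount (suc k) (suc k + n) ≡
    regularCount k (suc k + n) + countRegular (map (suc k ∷_) (partitions≤ n (suc k) n))
  regularCount-split k n = trans
    (cong countRegular (partitions≤-suc (k + n) k (k + n) (m≤m+n k n)))
    (trans (countRegular-++ (partitions≤ (suc k + n) k (suc k + n)) _)
      (cong (λ xss → regularCount k (suc k + n) + countRegular (map (suc k ∷_) xss))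
        (trans (cong (partitions≤ (k + n) (suc k)) (m+n∸m≡n k n))
          (partitions≤-fuel (k + n) n (suc k) n (m≤n+m n k) ≤-refl))))

  -- Mod 2, the product of 1/(1 - q^j) over j ≤ k with ℓ ∤ j. It is characterised one k at a time
  -- and with denominators multiplied out.
  regularSeries : ℕ → Series
  regularSeries k n = parity (regularCount k n)

  regularSeries-0 : regularSeries 0 ≈ 1#
  regularSeries-0 zero    = refl
  regularSeries-0 (suc n) = refl

  regularSeries-∣ : ∀ k → ℓ ∣ suc k → regularSeries (suc k) ≈ regularSeries k
  regularSeries-∣ k ℓ∣1+k n with ≤-<-connex n k
  ... | inj₁ n≤k = cong parity (regularCount-< k n n≤k)
  ... | inj₂ k<n with j , refl ← m≤n⇒∃[o]m+o≡n k<n = cong parity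
    (trans (regularCount-split k j)
      (trans (cong (regularCount k (suc k + j) +_) (countRegular-∷-∣ ℓ∣1+k (partitions≤ j (suc k) j)))
      (+-identityʳ _)))

  regularSeries-∤ : ∀ k → ¬ ℓ ∣ suc k → (1# ⊕ X ^ˢ suc k) ⊗ regularSeries (suc k) ≈ regularSeries k
  regularSeries-∤ k ℓ∤1+k n = trans
    (solve 2 (λ x r → (con 1ℙ :+ x) :* r := r :+ x :* r) ≈-refl (X ^ˢ suc k) (regularSeries (suc k)) n)
    (coefficient (≤-<-connex n k))
    where
    open ≡-Reasoning
    coefficient : n ≤ k ⊎ k < n → (regularSeries (suc k) ⊕ X ^ˢ suc k ⊗ regularSeries (suc k)) n ≡ regularSeries k n
    coefficient (inj₁ n≤k) = trans
      (cong₂ ℙ._+_ (cong parity (regularCount-< k n n≤k)) (X^-⊗-< (suc k) (regularSeries (suc k)) (s≤s n≤k)))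
      (ℙ.+-identityʳ (regularSeries k n))
    coefficient (inj₂ k<n) with j , refl ← m≤n⇒∃[o]m+o≡n k<n = begin
      parity (regularCount (suc k) (suc k + j)) ℙ.+ (X ^ˢ suc k ⊗ regularSeries (suc k)) (suc k + j)
        ≡⟨ cong₂ (λ c d → parity c ℙ.+ d)
             (trans (regularCount-split k j)
               (cong (regularCount k (suc k + j) +_) (countRegular-∷-∤ ℓ∤1+k (partitions≤ j (suc k) j))))
             (X^-⊗-+ (suc k) (regularSeries (suc k)) j) ⟩
      parity (regularCount k (suc k + j) + regularCount (suc k) j) ℙ.+ regularSeries (suc k) j
        ≡⟨ cong (ℙ._+ regularSeries (suc k) j) (ℙ.+-homo-+ (regularCount k (suc k + j)) (regularCount (suc k) j)) ⟩
      regularSeries k (suc k + j) ℙ.+ regularSeries (suc k) j ℙ.+ regularSeries (suc k) j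
        ≡⟨ solve′ 2 (λ x y → (x :+′ y) :+′ y :=′ x) refl (regularSeries k (suc k + j)) (regularSeries (suc k) j) ⟩
      regularSeries k (suc k + j) ∎
      where
      open ParitySolver using () renaming (solve to solve′; _:+_ to _:+′_; _:=_ to _:=′_)

  -- None of mℓ + 1, ..., mℓ + j is a multiple of ℓ, so each new Euler factor is absorbed by the
  -- denominator of `regularSeries`. Only the multiples of ℓ, handled in `euler-regular`, leave a
  -- factor behind.
  euler-regular-step : ∀ m j → j < ℓ →
    eulerProduct X (j + m * ℓ) ⊗ regularSeries (j + m * ℓ) ≈
    eulerProduct X (m * ℓ) ⊗ regularSeries (m * ℓ)
  euler-regular-step m zero    _     = ≈-refl
  euler-regular-step m (suc j) 1+j<ℓ = begin
    (1# ⊕ X ^ˢ suc k) ⊗ eulerProduct X k ⊗ regularSeries (suc k)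
      ≈⟨ solve 3 (λ x p r → x :* p :* r := p :* (x :* r)) ≈-refl
         (1# ⊕ X ^ˢ suc k) (eulerProduct X k) (regularSeries (suc k)) ⟩
    eulerProduct X k ⊗ ((1# ⊕ X ^ˢ suc k) ⊗ regularSeries (suc k))
      ≈⟨ ⊗-congˡ {eulerProduct X k} (regularSeries-∤ k ℓ∤1+k) ⟩
    eulerProduct X k ⊗ regularSeries k
      ≈⟨ euler-regular-step m j (<-trans (n<1+n j) 1+j<ℓ) ⟩
    eulerProduct X (m * ℓ) ⊗ regularSeries (m * ℓ) ∎
    where
    open ≈-Reasoning
    k = j + m * ℓ
    ℓ∤1+k : ¬ ℓ ∣ suc k
    ℓ∤1+k ℓ∣1+k = <⇒≱ 1+j<ℓ (∣⇒≤ (∣m+n∣m⇒∣n (subst (ℓ ∣_) (+-comm (suc j) (m * ℓ)) ℓ∣1+k) (n∣m*n m)))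

euler-regular : ∀ l m → eulerProduct X (m * suc l) ⊗ regularSeries (suc l) (m * suc l)
  ≈ eulerProduct (X ^ˢ suc l) m
euler-regular l zero    = ≈-trans (⊗-congˡ {1#} (regularSeries-0 (suc l)))
  (solve 0 (con 1ℙ :* con 1ℙ := con 1ℙ) ≈-refl)
euler-regular l (suc m) = begin
  (1# ⊕ X ^ˢ suc k) ⊗ eulerProduct X k ⊗ regularSeries ℓ (suc k)
    ≈⟨ ⊗-congˡ {eulerProduct X (suc k)} (regularSeries-∣ ℓ k (n∣m*n (suc m))) ⟩
  (1# ⊕ X ^ˢ suc k) ⊗ eulerProduct X k ⊗ regularSeries ℓ k
    ≈⟨ solve 3 (λ x p r → x :* p :* r := x :* (p :* r)) ≈-refl
         (1# ⊕ X ^ˢ suc k) (eulerProduct X k) (regularSeries ℓ k) ⟩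
  (1# ⊕ X ^ˢ suc k) ⊗ (eulerProduct X k ⊗ regularSeries ℓ k)
    ≈⟨ ⊗-cong (⊕-congˡ {1#} (≈-trans (^ˢ-congʳ X (*-comm (suc m) ℓ)) (≈-sym (^ˢ-assocʳ X ℓ (suc m)))))
         (≈-trans (euler-regular-step ℓ m l (n<1+n l)) (euler-regular l m)) ⟩
  eulerProduct (X ^ˢ ℓ) (suc m) ∎
  where
  open ≈-Reasoning
  ℓ = suc l
  k = l + m * suc l

b₈-series : ∀ n → let m = suc n in
  regularSeries 8 (m * 8) ≈[ n ] pentagonalSum (X ^ˢ 4) m ⊗ triangularSum X (m * 8)
b₈-series n = ⊗-cancelˡ-[] (eulerProduct X (m * 8)) (eulerProduct-X-0 (m * 8)) (begin
  eulerProduct X (m * 8) ⊗ regularSeries 8 (m * 8)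
    ≈⟨ ≈⇒≈[] (euler-regular 7 m) ⟩
  eulerProduct (X ^ˢ 8) m
    ≈⟨ ≈⇒≈[] (≈-trans (eulerProduct-cong (≈-sym (^ˢ-assocʳ X 4 2)) m) (eulerProduct-square (X ^ˢ 4) m)) ⟩
  F ⊗ F
    ≈⟨ ⊗-cong-[] {g = F} F≈P (λ _ _ → refl) ⟩
  P ⊗ F
    -- Gauss's identity at length 8m involves 4m factors of f₄, while f₈ supplied only m. The 3m
    -- missing factors affect degrees from 4m on, and m = n + 1 ensures n < 4m.
    ≈⟨ ⊗-cong-[] {f = P} (λ _ _ → refl) F≈ ⟩
  P ⊗ eulerProduct (X ^ˢ 4) (m * 3 + m)
    ≡⟨ cong (λ k → P ⊗ eulerProduct (X ^ˢ 4) k) (m*3+m m) ⟩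
  P ⊗ eulerProduct (X ^ˢ 4) (m * 4)
    ≈⟨ ⊗-cong-[] {f = P} (λ _ _ → refl) gauss ⟨
  P ⊗ (eulerProduct X (m * 8) ⊗ T)
    ≈⟨ ≈⇒≈[] (solve 3 (λ p e t → p :* (e :* t) := e :* (p :* t)) ≈-refl P (eulerProduct X (m * 8)) T) ⟩
  eulerProduct X (m * 8) ⊗ (P ⊗ T) ∎)
  where
  open Relation.Binary.Reasoning.Setoid (truncated n)
  m = suc n
  F = eulerProduct (X ^ˢ 4) m
  P = pentagonalSum (X ^ˢ 4) m
  T = triangularSum X (m * 8)
  m*3+m : ∀ m → m * 3 + m ≡ m * 4
  m*3+m = solve-∀
  2*[m*4] : ∀ m → 2 * (m * 4) ≡ m * 8
  2*[m*4] = solve-∀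
  mod-X : ∀ {f g} → ∃[ h ] f ≈ g ⊕ (X ^ˢ 4) ^ˢ m ⊗ h → f ≈[ n ] g
  mod-X {f} {g} (h , p) = X^-≈[] {h = h} (<-≤-trans (n<1+n n) (m≤m+n m _))
    (≈-trans p (⊕-congˡ {g} (⊗-congʳ {h} (^ˢ-assocʳ X 4 m))))
  F≈P : F ≈[ n ] P
  F≈P k k≤n = sym (mod-X {g = F} (euler-pentagonal (X ^ˢ 4) m) k k≤n)
  F≈ : F ≈[ n ] eulerProduct (X ^ˢ 4) (m * 3 + m)
  F≈ k k≤n = sym (mod-X {g = F} (eulerProduct-mod (X ^ˢ 4) m (m * 3)) k k≤n)
  gauss : eulerProduct X (m * 8) ⊗ T ≈[ n ] eulerProduct (X ^ˢ 4) (m * 4)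
  gauss k k≤n = subst (λ i → (eulerProduct X i ⊗ triangularSum X i) k ≡ eulerProduct (X ^ˢ 4) (m * 4) k)
    (2*[m*4] m) (gauss-triangular (m * 4) k (≤-trans k≤n (≤-trans (n≤1+n n)
      (subst (m ≤_) (sym (2*[m*4] m)) (m≤m*n m 8)))))

-- Exponents with odd coefficients

ℙ-+-support : ∀ {a c : Parity} → a ℙ.+ c ≡ 1ℙ → a ≡ 1ℙ ⊎ c ≡ 1ℙ
ℙ-+-support {0ℙ} p = inj₂ p
ℙ-+-support {1ℙ} p = inj₁ refl

ℙ-*-support : ∀ {a c : Parity} → a ℙ.* c ≡ 1ℙ → a ≡ 1ℙ × c ≡ 1ℙ
ℙ-*-support {1ℙ} p = refl , p

-- A single odd term is all that is extracted. How many there are, and whether some cancel, does not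
-- matter, because the theorem rests on there being no representation at all.
⊗-support : ∀ f g n → (f ⊗ g) n ≡ 1ℙ → ∃[ i ] ∃[ j ] i + j ≡ n × f i ≡ 1ℙ × g j ≡ 1ℙ
⊗-support f g zero    p = 0 , 0 , refl , ℙ-*-support p
⊗-support f g (suc n) p with ℙ-+-support p
... | inj₁ q = 0 , suc n , refl , ℙ-*-support q
... | inj₂ q with i , j , eq , fi , gj ← ⊗-support (f ∘ suc) g n q = suc i , j , cong suc eq , fi , gj

X^-support : ∀ k {n} → (X ^ˢ k) n ≡ 1ℙ → n ≡ k
X^-support zero    {zero}  _ = refl
X^-support (suc k) {suc n} p = cong suc (X^-support k (trans (sym (X-⊗-suc (X ^ˢ k) n)) p))

2*triangle : ∀ n → 2 * triangle n ≡ n * suc n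
2*triangle zero    = refl
2*triangle (suc n) = trans (*-distribˡ-+ 2 (suc n) (triangle n))
  (trans (cong (2 * suc n +_) (2*triangle n)) (arithmetic n))
  where
  arithmetic : ∀ n → 2 * suc n + n * suc n ≡ suc n * suc (suc n)
  arithmetic = solve-∀

-- Completing the square: 8T + 1 = (2k + 1)² for the k-th triangular number T, multiplied by 3.
triangularSum-support : ∀ k {n} → triangularSum X k n ≡ 1ℙ → ∃[ y ] 24 * n + 3 ≡ 3 * (y * y)
triangularSum-support zero    {zero} _ = 1 , refl
triangularSum-support (suc k) {n} p with ℙ-+-support {triangularSum X k n} {(X ^ˢ triangle (suc k)) n} p
... | inj₁ q = triangularSum-support k q
... | inj₂ q with refl ← X^-support (triangle (suc k)) {n} q = 2 * suc k + 1 ,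
  trans (regroup (triangle (suc k))) (trans (cong (λ t → 12 * t + 3) (2*triangle (suc k))) (square (suc k)))
  where
  regroup : ∀ t → 24 * t + 3 ≡ 12 * (2 * t) + 3
  regroup = solve-∀
  square : ∀ k → 12 * (k * suc k) + 3 ≡ 3 * ((2 * k + 1) * (2 * k + 1))
  square = solve-∀

-- With m = k + 1, e = m(3m - 1)/2 and 24e + 1 = (6m - 1)², so the root is 2(6m - 1) = 12k + 10. For
-- the other sign, in `pentagonal₊-square`, it is 2(6m + 1) = 12k + 14.
pentagonal₋-square : ∀ k → let e = triangle (suc k) + k * suc k in
  24 * (4 * e) + 4 ≡ (12 * k + 10) * (12 * k + 10)
pentagonal₋-square k = trans (regroup e) (trans (cong (λ d → 48 * d + 4) double) (square k))
  where
  e = triangle (suc k) + k * suc k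
  regroup : ∀ e → 24 * (4 * e) + 4 ≡ 48 * (2 * e) + 4
  regroup = solve-∀
  collect : ∀ k → suc k * suc (suc k) + 2 * (k * suc k) ≡ suc k * (3 * k + 2)
  collect = solve-∀
  double : 2 * e ≡ suc k * (3 * k + 2)
  double = trans (*-distribˡ-+ 2 (triangle (suc k)) (k * suc k))
    (trans (cong (_+ 2 * (k * suc k)) (2*triangle (suc k))) (collect k))
  square : ∀ k → 48 * (suc k * (3 * k + 2)) + 4 ≡ (12 * k + 10) * (12 * k + 10)
  square = solve-∀

pentagonal₊-square : ∀ k → let e = triangle (suc k) + suc k * suc k in
  24 * (4 * e) + 4 ≡ (12 * k + 14) * (12 * k + 14)
pentagonal₊-square k = trans (regroup e) (trans (cong (λ d → 48 * d + 4) double) (square k))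
  where
  e = triangle (suc k) + suc k * suc k
  regroup : ∀ e → 24 * (4 * e) + 4 ≡ 48 * (2 * e) + 4
  regroup = solve-∀
  collect : ∀ k → suc k * suc (suc k) + 2 * (suc k * suc k) ≡ suc k * (3 * k + 4)
  collect = solve-∀
  double : 2 * e ≡ suc k * (3 * k + 4)
  double = trans (*-distribˡ-+ 2 (triangle (suc k)) (suc k * suc k))
    (trans (cong (_+ 2 * (suc k * suc k)) (2*triangle (suc k))) (collect k))
  square : ∀ k → 48 * (suc k * (3 * k + 4)) + 4 ≡ (12 * k + 14) * (12 * k + 14)
  square = solve-∀

pentagonalSum-support : ∀ k {n} → pentagonalSum (X ^ˢ 4) k n ≡ 1ℙ → ∃[ x ] 24 * n + 4 ≡ x * x
pentagonalSum-support zero    {zero} _ = 2 , refl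
pentagonalSum-support (suc k) {n} p =
  [ [ pentagonalSum-support k , lower ]′ ∘ ℙ-+-support {pentagonalSum (X ^ˢ 4) k n} , upper ]′
  (ℙ-+-support {pentagonalSum (X ^ˢ 4) k n ℙ.+ ((X ^ˢ 4) ^ˢ (triangle (suc k) + k * suc k)) n} p)
  where
  exponent : ∀ e → ((X ^ˢ 4) ^ˢ e) n ≡ 1ℙ → n ≡ 4 * e
  exponent e q = X^-support (4 * e) (trans (sym (^ˢ-assocʳ X 4 e n)) q)
  lower : ((X ^ˢ 4) ^ˢ (triangle (suc k) + k * suc k)) n ≡ 1ℙ → ∃[ x ] 24 * n + 4 ≡ x * x
  lower q = 12 * k + 10 ,
    trans (cong (λ i → 24 * i + 4) (exponent (triangle (suc k) + k * suc k) q)) (pentagonal₋-square k)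
  upper : ((X ^ˢ 4) ^ˢ (triangle (suc k) + suc k * suc k)) n ≡ 1ℙ → ∃[ x ] 24 * n + 4 ≡ x * x
  upper q = 12 * k + 14 ,
    trans (cong (λ i → 24 * i + 4) (exponent (triangle (suc k) + suc k * suc k) q)) (pentagonal₊-square k)

parity≡0⇒2∣ : ∀ n → parity n ≡ 0ℙ → 2 ∣ n
parity≡0⇒2∣ zero          _ = divides 0 refl
parity≡0⇒2∣ (suc (suc n)) p = ∣m∣n⇒∣m+n ∣-refl (parity≡0⇒2∣ n p)

b₈-odd⇒form : ∀ n → ¬ 2 ∣ b 8 n → ∃[ x ] ∃[ y ] 24 * n + 7 ≡ x * x + 3 * (y * y)
b₈-odd⇒form n 2∤b = combine (⊗-support (pentagonalSum (X ^ˢ 4) (suc n)) (triangularSum X (suc n * 8)) n coefficient)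
  where
  odd : ∀ c → (c ≡ 0ℙ → 2 ∣ b 8 n) → c ≡ 1ℙ
  odd 0ℙ h = contradiction (h refl) 2∤b
  odd 1ℙ h = refl
  coefficient : (pentagonalSum (X ^ˢ 4) (suc n) ⊗ triangularSum X (suc n * 8)) n ≡ 1ℙ
  coefficient = trans (sym (b₈-series n n ≤-refl))
    (trans (cong parity (regularCount-saturated 8 {suc n * 8} {n} (≤-trans (n≤1+n n) (m≤m*n (suc n) 8))))
      (odd (parity (b 8 n)) (parity≡0⇒2∣ (b 8 n))))
  split : ∀ i j → 24 * (i + j) + 7 ≡ 24 * i + 4 + (24 * j + 3)
  split = solve-∀
  combine : ∃[ i ] ∃[ j ] i + j ≡ n ×
    pentagonalSum (X ^ˢ 4) (suc n) i ≡ 1ℙ × triangularSum X (suc n * 8) j ≡ 1ℙ →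
    ∃[ x ] ∃[ y ] 24 * n + 7 ≡ x * x + 3 * (y * y)
  combine (i , j , i+j≡n , pᵢ , tⱼ) = proj₁ square , proj₁ triple ,
    trans (cong (λ k → 24 * k + 7) (sym i+j≡n)) (trans (split i j) (cong₂ _+_ (proj₂ square) (proj₂ triple)))
    where
    square = pentagonalSum-support (suc n) pᵢ
    triple = triangularSum-support (suc n * 8) tⱼ

-- Primes p ≡ 2 (mod 3) and the form x² + 3y²

∣-sum : ∀ {d n} (t : Vector ℕ n) → (∀ i → d ∣ t i) → d ∣ sum t
∣-sum {n = zero}  t _ = _ ∣0
∣-sum {n = suc n} t h = ∣m∣n⇒∣m+n (h Fin.zero) (∣-sum (t ∘ Fin.suc) (h ∘ Fin.suc))

×≡* : ∀ n x → n Mult.× x ≡ n * x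
×≡* zero    x = refl
×≡* (suc n) x = cong (x +_) (×≡* n x)

exp≡^ : ∀ x n → x Exp.^ n ≡ x ^ n
exp≡^ x zero    = refl
exp≡^ x (suc n) = cong (x *_) (exp≡^ x n)

∣!⇒≤ : ∀ {p} → Prime p → ∀ n → p ∣ n ! → p ≤ n
∣!⇒≤ {p} pr zero    p∣1  = contradiction (∣⇒≤ p∣1) (<⇒≱ (nonTrivial⇒n>1 p {{prime⇒nonTrivial pr}}))
∣!⇒≤ {p} pr (suc n) p∣n! = [ ∣⇒≤ , m≤n⇒m≤1+n ∘ ∣!⇒≤ pr n ]′ (euclidsLemma (suc n) (n !) pr p∣n!)

-- A prime divides its own factorial, which is the binomial coefficient times two factorials of
-- smaller numbers, and it divides neither of those.
prime∣C : ∀ {p k} → Prime (suc p) → k < p → suc p ∣ suc p C suc k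
prime∣C {p′} {k′} pr k<p = [ id , (λ q → contradiction q p∤k![p∸k]!) ]′
  (euclidsLemma (p C k) (k ! * (p ∸ k) !) pr
    (subst (p ∣_) (sym (trans (cong (_* (k ! * (p ∸ k) !)) (nCk≡n!/k![n-k]! k≤p)) (m/n*n≡m (k![n∸k]!∣n! k≤p))))
      (m∣m*n (p′ !))))
  where
  p = suc p′
  k = suc k′
  k≤p : k ≤ p
  k≤p = m≤n⇒m≤1+n k<p
  instance
    _ = m*n≢0 (k !) ((p ∸ k) !) {{k !≢0}} {{(p ∸ k) !≢0}}
  p∤k![p∸k]! : ¬ p ∣ k ! * (p ∸ k) !
  p∤k![p∸k]! h = [ (λ q → contradiction (∣!⇒≤ pr k q) (<⇒≱ (s≤s k<p)))
                 , (λ q → contradiction (∣!⇒≤ pr (p ∸ k) q) (<⇒≱ (∸-monoʳ-< (s≤s z≤n) k≤p))) ]′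
                 (euclidsLemma (k !) ((p ∸ k) !) pr h)

-- All inner binomial terms are divisible by p. The quotient is exhibited so that the congruence is
-- an equation in ℕ, ready for rewriting in `fermat`.
frobenius : ∀ {p} → Prime p → ∀ u → ∃[ c ] (u + 1) ^ p ≡ u ^ p + 1 + p * c
frobenius {zero}  pr u = contradiction refl (≢-nonZero⁻¹ 0 {{prime⇒nonZero pr}})
frobenius {suc m} pr u = c , (begin
  (u + 1) ^ suc m                      ≡⟨ exp≡^ (u + 1) (suc m) ⟨
  (u + 1) Exp.^ suc m                  ≡⟨ Binomial.theorem (suc m) u 1 ⟩
  t Fin.zero + sum (t ∘ Fin.suc)       ≡⟨ cong₂ _+_ first
    (trans (sum-init-last (t ∘ Fin.suc)) (cong₂ _+_ (_∣_.equality inner) final)) ⟩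
  1 + (c * suc m + u ^ suc m)          ≡⟨ rearrange c (suc m) (u ^ suc m) ⟩
  u ^ suc m + 1 + suc m * c            ∎)
  where
  open ≡-Reasoning
  t = Binomial.binomialTerm u 1 (suc m)
  1^ : ∀ n → 1 Exp.^ n ≡ 1
  1^ n = trans (exp≡^ 1 n) (^-zeroˡ n)
  first : t Fin.zero ≡ 1
  first = trans (×≡* 1 _) (trans (*-identityˡ _) (trans (*-identityˡ _) (1^ (suc m))))
  final : t (Fin.suc (fromℕ m)) ≡ u ^ suc m
  final = begin
    (suc m C suc (toℕ (fromℕ m))) Mult.× (u Exp.^ suc (toℕ (fromℕ m)) * 1 Exp.^ (m ∸ toℕ (fromℕ m)))
      ≡⟨ ×≡* (suc m C suc (toℕ (fromℕ m))) _ ⟩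
    (suc m C suc (toℕ (fromℕ m))) * (u Exp.^ suc (toℕ (fromℕ m)) * 1 Exp.^ (m ∸ toℕ (fromℕ m)))
      ≡⟨ cong₂ _*_ (trans (cong (λ i → suc m C suc i) (toℕ-fromℕ m)) (nCn≡1 (suc m)))
           (cong₂ _*_ (trans (exp≡^ u (suc (toℕ (fromℕ m)))) (cong (λ i → u ^ suc i) (toℕ-fromℕ m)))
             (1^ (m ∸ toℕ (fromℕ m)))) ⟩
    1 * (u ^ suc m * 1) ≡⟨ trans (*-identityˡ _) (*-identityʳ _) ⟩
    u ^ suc m ∎
  middle : ∀ i → suc m ∣ t (Fin.suc (inject₁ i))
  middle i = subst (suc m ∣_) (sym (×≡* (suc m C suc (toℕ (inject₁ i))) _))
    (∣m⇒∣m*n _ (prime∣C pr (subst (_< m) (sym (toℕ-inject₁ i)) (toℕ<n i))))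
  inner = ∣-sum (λ i → t (Fin.suc (inject₁ i))) middle
  c = _∣_.quotient inner
  rearrange : ∀ c p x → 1 + (c * p + x) ≡ x + 1 + p * c
  rearrange = solve-∀

fermat : ∀ {p} → Prime p → ∀ u → ∃[ c ] u ^ p ≡ u + p * c
fermat {p} pr zero = 0 , trans (cong (0 ^_) (sym (suc-pred p {{prime⇒nonZero pr}}))) (sym (*-zeroʳ p))
fermat {p} pr (suc u) with c , eq ← fermat pr u with d , eq′ ← frobenius pr u = c + d , (begin
  suc u ^ p             ≡⟨ cong (_^ p) (+-comm 1 u) ⟩
  (u + 1) ^ p           ≡⟨ eq′ ⟩
  u ^ p + 1 + p * d     ≡⟨ cong (λ t → t + 1 + p * d) eq ⟩
  u + p * c + 1 + p * d ≡⟨ rearrange u p c d ⟩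
  suc u + p * (c + d)   ∎)
  where
  open ≡-Reasoning
  rearrange : ∀ u p c d → u + p * c + 1 + p * d ≡ suc u + p * (c + d)
  rearrange = solve-∀

-- Induction through (x + y)(x^(m+1) + y^(m+1)) = xy(x^m + y^m) + (x^(m+2) + y^(m+2)), which avoids
-- the alternating cofactor and hence subtraction.
+∣odd-powers : ∀ x y j → x + y ∣ x ^ suc (2 * j) + y ^ suc (2 * j)
+∣odd-powers x y zero    = ∣-reflexive (cong₂ _+_ (sym (*-identityʳ x)) (sym (*-identityʳ y)))
+∣odd-powers x y (suc j) = subst (λ k → x + y ∣ x ^ suc k + y ^ suc k) (sym (*-suc 2 j))
  (∣m+n∣m⇒∣n (subst (x + y ∣_) (expand x y (x ^ suc (2 * j)) (y ^ suc (2 * j))) (m∣m*n _))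
    (∣n⇒∣m*n (x * y) (+∣odd-powers x y j)))
  where
  expand : ∀ x y a c → (x + y) * (x * a + y * c) ≡ x * y * (a + c) + (x * (x * a) + y * (y * c))
  expand = solve-∀

-- Such p stay prime in the Eisenstein integers: -3 is not a square mod p. This is obtained from
-- cubing rather than from quadratic reciprocity. The form 5 + 6t also gives p ≥ 5, so 2, 3 and 4
-- can be cancelled.
module Inert (p t : ℕ) (p≡5+6t : p ≡ 5 + t * 6) (pr : Prime p) where

  private instance
    _ = prime⇒nonZero pr

  ∤<5 : ∀ {k} → .{{NonZero k}} → k < 5 → ¬ p ∣ k
  ∤<5 k<5 p∣k = <⇒≱ k<5 (≤-trans (subst (5 ≤_) (sym p≡5+6t) (m≤m+n 5 (t * 6))) (∣⇒≤ p∣k))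

  ∣c*⇒∣ : ∀ c .{{_ : NonZero c}} {k} → c < 5 → p ∣ c * k → p ∣ k
  ∣c*⇒∣ c {k} c<5 h = [ (λ q → contradiction q (∤<5 c<5)) , id ]′ (euclidsLemma c k pr h)

  ∣2*⇒∣ : ∀ {k} → p ∣ 2 * k → p ∣ k
  ∣2*⇒∣ = ∣c*⇒∣ 2 (m≤n+m 3 2)

  ∣3*⇒∣ : ∀ {k} → p ∣ 3 * k → p ∣ k
  ∣3*⇒∣ = ∣c*⇒∣ 3 (m≤n+m 4 1)

  ∣4*⇒∣ : ∀ {k} → p ∣ 4 * k → p ∣ k
  ∣4*⇒∣ = ∣c*⇒∣ 4 (n<1+n 4)

  ∣square⇒∣ : ∀ {k} → p ∣ k * k → p ∣ k
  ∣square⇒∣ {k} h = [ id , id ]′ (euclidsLemma k k pr h)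

  -- As p ≡ 2 (mod 3), cubing is injective mod p: with p = 2 + 3(2t + 1),
  -- Fermat turns u²v²(u^(p-2) + v^(p-2)) into uv(u + v).
  ∣cubes⇒∣ : ∀ u v → p ∣ u ^ 3 + v ^ 3 → p ∣ u * (v * (u + v))
  ∣cubes⇒∣ u v h with c , eqᵤ ← fermat pr u with d , eqᵥ ← fermat pr v =
    ∣m+n∣m⇒∣n (subst (p ∣_) (begin
        (u ^ 2 * v ^ 2) * (x ^ suc (2 * t) + y ^ suc (2 * t))
          ≡⟨ cong (λ s → (u ^ 2 * v ^ 2) * s) (cong₂ _+_ (power u) (power v)) ⟩
        (u ^ 2 * v ^ 2) * (u ^ (3 + t * 6) + v ^ (3 + t * 6))
          ≡⟨ regroup u v (u ^ (3 + t * 6)) (v ^ (3 + t * 6)) ⟩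
        v ^ 2 * u ^ (5 + t * 6) + u ^ 2 * v ^ (5 + t * 6)
          ≡⟨ cong (λ e → v ^ 2 * u ^ e + u ^ 2 * v ^ e) p≡5+6t ⟨
        v ^ 2 * u ^ p + u ^ 2 * v ^ p
          ≡⟨ cong₂ (λ a b → v ^ 2 * a + u ^ 2 * b) eqᵤ eqᵥ ⟩
        v ^ 2 * (u + p * c) + u ^ 2 * (v + p * d)
          ≡⟨ collect u v c d p ⟩
        p * (v ^ 2 * c + u ^ 2 * d) + u * (v * (u + v)) ∎)
      (∣n⇒∣m*n (u ^ 2 * v ^ 2) (∣-trans h (+∣odd-powers x y t))))
    (m∣m*n (v ^ 2 * c + u ^ 2 * d))
    where
    open ≡-Reasoning
    x = u ^ 3
    y = v ^ 3
    power : ∀ u → (u ^ 3) ^ suc (2 * t) ≡ u ^ (3 + t * 6)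
    power u = trans (^-*-assoc u 3 (suc (2 * t))) (cong (u ^_) (exponent t))
      where
      exponent : ∀ t → 3 * suc (2 * t) ≡ 3 + t * 6
      exponent = solve-∀
    regroup : ∀ u v a b → (u * (u * 1)) * (v * (v * 1)) * (a + b) ≡
      v * (v * 1) * (u * (u * a)) + u * (u * 1) * (v * (v * b))
    regroup = solve-∀
    collect : ∀ u v c d p → v * (v * 1) * (u + p * c) + u * (u * 1) * (v + p * d) ≡
      p * (v * (v * 1) * c + u * (u * 1) * d) + u * (v * (u + v))
    collect = solve-∀

  -- x² ≡ -3y² makes (x + y)³ + (2y)³ vanish mod p.
  ∣form⇒∣ʳ : ∀ x y → p ∣ x * x + 3 * (y * y) → p ∣ y
  ∣form⇒∣ʳ x y h = [ case₁ , [ ∣2*⇒∣ , case₂ ]′ ∘ euclidsLemma (2 * y) (x + y + 2 * y) pr ]′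
    (euclidsLemma (x + y) (2 * y * (x + y + 2 * y)) pr
      (∣cubes⇒∣ (x + y) (2 * y) (subst (p ∣_) (factor x y) (∣n⇒∣m*n (x + 3 * y) h))))
    where
    -- The sum of two cubes at u = x + y, v = 2y: here u + v = x + 3y and u² - uv + v² = x² + 3y².
    factor : ∀ x y → (x + 3 * y) * (x * x + 3 * (y * y)) ≡
      (x + y) * ((x + y) * ((x + y) * 1)) + 2 * y * (2 * y * (2 * y * 1))
    factor = solve-∀
    combine₁ : ∀ x y → x * x + 3 * (y * y) + y * (x + y) ≡ x * (x + y) + 4 * (y * y)
    combine₁ = solve-∀
    combine₂ : ∀ x y → x * x + 3 * (y * y) + 3 * y * (x + y + 2 * y) ≡ x * (x + y + 2 * y) + 3 * (4 * (y * y))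
    combine₂ = solve-∀
    -- If x ≡ -y, the form is 4y² mod p; in `case₂`, x ≡ -3y makes it 12y².
    case₁ : p ∣ x + y → p ∣ y
    case₁ q = ∣square⇒∣ (∣4*⇒∣ (∣m+n∣m⇒∣n
      (subst (p ∣_) (combine₁ x y) (∣m∣n⇒∣m+n h (∣n⇒∣m*n y q))) (∣n⇒∣m*n x q)))
    case₂ : p ∣ x + y + 2 * y → p ∣ y
    case₂ q = ∣square⇒∣ (∣4*⇒∣ (∣3*⇒∣ (∣m+n∣m⇒∣n
      (subst (p ∣_) (combine₂ x y) (∣m∣n⇒∣m+n h (∣n⇒∣m*n (3 * y) q))) (∣n⇒∣m*n x q))))

  ∣form⇒∣ˡ : ∀ x y → p ∣ x * x + 3 * (y * y) → p ∣ x
  ∣form⇒∣ˡ x y h = ∣square⇒∣ (∣m+n∣m⇒∣n (subst (p ∣_) (+-comm (x * x) _) h)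
    (∣n⇒∣m*n 3 (∣n⇒∣m*n y (∣form⇒∣ʳ x y h))))

  -- Descent: p divides x and y, so p² can be cancelled and the exponent drops by 2. When a single p
  -- is left on the right, p² still divides the left side, and the second p must come from w.
  form-valuation : ∀ a x y w → x * x + 3 * (y * y) ≡ p ^ suc (2 * a) * w → p ∣ w
  form-valuation a x y w eq = descend a (∣form⇒∣ˡ x y p∣form) (∣form⇒∣ʳ x y p∣form) eq
    where
    p∣form : p ∣ x * x + 3 * (y * y)
    p∣form = subst (p ∣_) (sym eq) (∣m⇒∣m*n w (m∣m*n (p ^ (2 * a))))
    scale : ∀ x y p → x * p * (x * p) + 3 * (y * p * (y * p)) ≡ p * (p * (x * x + 3 * (y * y)))
    scale = solve-∀
    assoc : ∀ p z w → p * (p * z) * w ≡ p * (p * (z * w))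
    assoc = solve-∀
    descend : ∀ a {x y} → p ∣ x → p ∣ y → x * x + 3 * (y * y) ≡ p ^ suc (2 * a) * w → p ∣ w
    descend zero (divides x′ refl) (divides y′ refl) eq =
      subst (p ∣_) (*-cancelˡ-≡ _ w p (trans (sym (scale x′ y′ p)) (trans eq (cong (_* w) (*-identityʳ p)))))
        (m∣m*n (x′ * x′ + 3 * (y′ * y′)))
    descend (suc a) (divides x′ refl) (divides y′ refl) eq = form-valuation a x′ y′ w
      (*-cancelˡ-≡ _ _ p (*-cancelˡ-≡ _ _ p (trans (sym (scale x′ y′ p))
        (trans eq (trans (cong (λ e → p ^ suc e * w) (*-suc 2 a)) (assoc p (p ^ suc (2 * a)) w))))))

theorem3p22 : ∀ (p : ℕ) → Prime p → 6 ∣ p + 1 →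
    ∀ (α n : ℕ) → 1 ≤ α →
    ∀ (i : ℕ) → 1 ≤ i → i ≤ p ∸ 1 →
    2 ∣ b 8 (p ^ (2 * α) * n + ((24 * i + 7 * p) * p ^ (2 * α ∸ 1) ∸ 7) / 24)
theorem3p22 p pr (divides zero p+1≡0) α n 1≤α i 1≤i i≤p-1 =
  contradiction (trans (+-comm 1 p) p+1≡0) λ ()
theorem3p22 p pr 6∣p+1@(divides (suc t) p+1≡6+6t) α@(suc a) n 1≤α i 1≤i i≤p-1 =
  decidable-stable (2 ∣? b 8 N) λ odd → contradict (b₈-odd⇒form N odd)
  where
  instance
    _ = prime⇒nonZero pr
    _ = >-nonZero 1≤i
  P = p ^ (2 * α ∸ 1)
  Q = ((24 * i + 7 * p) * P ∸ 7) / 24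
  N = p ^ (2 * α) * n + Q
  -- The cofactor of p^(2α-1) in 24N + 7: multiplying by 24 undoes the quotient `Q`, after which
  -- every term contains that power.
  w = p * (24 * n + 7) + 24 * i
  p≡5+6t : p ≡ 5 + t * 6
  p≡5+6t = suc-injective (trans (+-comm 1 p) p+1≡6+6t)
  24N+7 : 24 * N + 7 ≡ p ^ suc (2 * a) * w
  24N+7 = begin
    24 * (p * P * n + Q) + 7                     ≡⟨ regroup p P n Q ⟩
    24 * (p * P * n) + (24 * Q + 7)              ≡⟨ cong (24 * (p * P * n) +_) (exact-quotient p 6∣p+1 α 1≤α i) ⟩
    24 * (p * P * n) + (24 * i + 7 * p) * P      ≡⟨ collect p P n i ⟩
    P * w                                        ≡⟨ cong (λ e → p ^ e * w) (+-suc a (a + 0)) ⟩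
    p ^ suc (2 * a) * w                          ∎
    where
    open ≡-Reasoning
    regroup : ∀ p P n Q → 24 * (p * P * n + Q) + 7 ≡ 24 * (p * P * n) + (24 * Q + 7)
    regroup = solve-∀
    collect : ∀ p P n i → 24 * (p * P * n) + (24 * i + 7 * p) * P ≡ P * (p * (24 * n + 7) + 24 * i)
    collect = solve-∀
  -- Mod p, w is 24i with 0 < i < p. The 24 is removed as 4 · 3 · 2, by factors smaller than 5.
  p∤w : ¬ p ∣ w
  p∤w p∣w = <⇒≱ (≤-<-trans i≤p-1 (∸-monoʳ-< (n<1+n 0) (≤-trans 1≤i (≤-trans i≤p-1 (m∸n≤m p 1)))))
    (∣⇒≤ (∣2*⇒∣ (∣3*⇒∣ (∣4*⇒∣ (subst (p ∣_) (factor i) (∣m+n∣m⇒∣n p∣w (m∣m*n (24 * n + 7))))))))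
    where
    open Inert p t p≡5+6t pr
    factor : ∀ i → 24 * i ≡ 4 * (3 * (2 * i))
    factor = solve-∀
  contradict : ¬ (∃[ x ] ∃[ y ] 24 * N + 7 ≡ x * x + 3 * (y * y))
  contradict (x , y , eq) = p∤w (Inert.form-valuation p t p≡5+6t pr a x y w (trans (sym eq) 24N+7))
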